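{- For every positive integer $n$, the number of vertex orbits of the Lucas cube is \[ o_V(\Lambda_n) = \frac{1}{2}\left(\frac{1}{n}\sum_{d\mid n}\varphi\!\left(\frac{n}{d}\right) L_d + \sum_{0\le a\le \lfloor n/2\rfloor}\binom{\lfloor n/2\rfloor - \lfloor (a+1)/2\rfloor}{\lfloor a/2\rfloor}\right). \]
   Context: A Lucas string of length $n$ is a binary string $u_1\cdots u_n$ with no two consecutive 1s and not both $u_1=1$ and $u_n=1$. The Lucas cube $\Lambda_n$ is the subgraph of the $n$-cube $Q_n$ (binary strings of length $n$, adjacent iff they differ in exactly one position) induced by the Lucas strings of length $n$. $o_V(\Lambda_n)$ is the number of orbits of ${\rm Aut}(\Lambda_n)$ acting on $V(\Lambda_n)$. $\varphi$ is Euler's totient function, $L_d$ are the Lucas numbers ($L_0=2$, $L_1=1$, $L_d=L_{d-1}+L_{d-2}$), and the first sum runs over positive divisors $d$ of $n$. -}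

module Defs where

open import Data.Bool using (Bool; true; false; _∧_; not; T)
open import Data.Nat using (ℕ; zero; suc; _+_; _*_; _∸_; ⌊_/2⌋; _≟_)
open import Data.Nat.Divisibility using (_∣_; _∣?_)
open import Data.Nat.DivMod using (_/_)
open import Data.Nat.GCD using (gcd)
open import Data.Nat.Combinatorics using (_C_)
open import Data.List using (List; []; _∷_; length; map; filter; upTo)
open import Data.Nat.ListAction using (sum)
open import Data.List.Relation.Unary.All using (All)
open import Data.List.Relation.Unary.Any using (Any)
open import Data.List.Relation.Unary.AllPairs using (AllPairs)
open import Data.Vec using (Vec; []; _∷_; head; last)
open import Data.Product using (Σ; _×_; _,_; proj₁)
open import Relation.Binary.PropositionalEquality using (_≡_)
open import Relation.Nullary using (¬_)
open import Function.Bundles using (_⇔_)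

noConsec : ∀ {n} → Vec Bool n → Bool
noConsec [] = true
noConsec (x ∷ []) = true
noConsec (x ∷ y ∷ xs) = not (x ∧ y) ∧ noConsec (y ∷ xs)

isLucas : ∀ {n} → Vec Bool n → Bool
isLucas [] = true
isLucas (x ∷ xs) = noConsec (x ∷ xs) ∧ not (head (x ∷ xs) ∧ last (x ∷ xs))

-- vertex set of Λₙ  (T is proof-irrelevant, so ≡ on V n is equality of strings)
V : ℕ → Set
V n = Σ (Vec Bool n) (λ u → T (isLucas u))

hamming : ∀ {n} → Vec Bool n → Vec Bool n → ℕ
hamming [] [] = 0
hamming (x ∷ xs) (y ∷ ys) = (if x ≟ᵇ y then 0 else 1) + hamming xs ys
  where
  open import Data.Bool using (if_then_else_)
  _≟ᵇ_ : Bool → Bool → Bool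
  true ≟ᵇ true = true
  false ≟ᵇ false = true
  _ ≟ᵇ _ = false

Adj : ∀ {n} → V n → V n → Set
Adj u v = hamming (proj₁ u) (proj₁ v) ≡ 1

record Aut (n : ℕ) : Set where
  field
    f   : V n → V n
    g   : V n → V n
    gf  : ∀ x → g (f x) ≡ x
    fg  : ∀ x → f (g x) ≡ x
    adj : ∀ x y → Adj x y ⇔ Adj (f x) (f y)

SameOrbit : ∀ {n} → V n → V n → Set
SameOrbit {n} u v = Σ (Aut n) (λ σ → Aut.f σ u ≡ v)

IsOrbitTransversal : ∀ n → List (V n) → Set
IsOrbitTransversal n reps =
  AllPairs (λ u v → ¬ SameOrbit u v) reps × (∀ v → Any (λ u → SameOrbit u v) reps)

φ : ℕ → ℕ
φ m = length (filter (λ k → gcd k m ≟ 1) (map suc (upTo m)))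

lucas : ℕ → ℕ
lucas 0 = 2
lucas 1 = 1
lucas (suc (suc d)) = lucas (suc d) + lucas d

divisors : ℕ → List ℕ
divisors n = filter (λ d → d ∣? n) (map suc (upTo n))

necklaceSum : ℕ → ℕ
necklaceSum n = sum (map (λ d → φ (n / suc (d ∸ 1)) * lucas d) (divisors n))

binomSum : ℕ → ℕ
binomSum n = sum (map (λ a → (⌊ n /2⌋ ∸ ⌊ suc a /2⌋) C ⌊ a /2⌋) (upTo (suc ⌊ n /2⌋)))

{-# OPTIONS --safe #-}

-- Rotations and reflections of the index cycle act on Λₙ, and Burnside's lemma counts the orbits of this
-- dihedral action: the rotation by c fixes the repetitions of the Lucas strings of length gcd(c, n), and the
-- reflections fix palindromes, counted by Fibonacci numbers. There are no further orbit identifications: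
-- the zero string is the only vertex of degree n, so an automorphism fixes it and permutes the strings with a
-- single one by some π. It then acts on every string through π, by induction on the number of ones, since a
-- string with ones at i ≠ j is determined by the results of clearing i and clearing j. As the pairs of
-- positions that can carry ones simultaneously are preserved, π is a symmetry of the n-cycle.
module Submission where

open import Defs
open import Data.Nat using (ℕ; _*_; _+_; _≥_)
open import Data.List using (List; length)
open import Data.Product using (Σ; _×_)
open import Relation.Binary.PropositionalEquality using (_≡_)

open import Data.Bool using (Bool; true; false; _∧_; _xor_; not; T; if_then_else_; _∨_)
open import Data.Bool.Properties using (T-irrelevant; ∧-zeroʳ; ∧-identityʳ; ∧-comm; ∧-assoc; T?)
import Data.Bool.Properties as Bool
open import Data.Nat using (zero; suc; _∸_; _≤_; _<_; z≤n; s≤s; s≤s⁻¹; _≟_; ⌊_/2⌋; ⌈_/2⌉)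
open import Data.Nat.Properties
open import Data.Nat.DivMod hiding (_mod_; _div_)
open import Data.Nat.Tactic.RingSolver using (solve-∀)
open import Data.Vec using (Vec; []; _∷_; _∷ʳ_; last; reverse; tail)
open import Data.Product using (∃; _,_; proj₁; proj₂)
open import Data.Sum using (_⊎_; inj₁; inj₂; [_,_]′)
open import Data.Empty using (⊥; ⊥-elim)
open import Data.Unit using (tt)
open import Function using (_∘_; id)
open import Function.Bundles using (mk⇔; Equivalence)
open import Relation.Nullary using (¬_; Dec; yes; no; does; contradiction)
import Relation.Nullary.Decidable as Dec
open import Relation.Binary.PropositionalEquality
open import Data.Vec.Properties using (≡-dec; reverse-∷; last-∷ʳ; ∷ʳ-injective; ∷-injective)
open import Data.Fin using (Fin; toℕ; fromℕ<; punchOut)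
open import Data.Fin.Properties using (pigeonhole; toℕ-fromℕ<; toℕ<n; punchOut-injective)
import Data.Fin.Properties as Fin
open import Data.List using ([]; _∷_; _++_; map; filter; upTo; deduplicate)
open import Data.List.Properties using (length-map; length-++; map-upTo; map-applyUpTo; length-upTo; map-∘)
open import Data.Nat.ListAction using (sum)
open import Data.List.Membership.Propositional using (_∈_)
open import Data.List.Membership.Propositional.Properties
  using (∈-++⁺ˡ; ∈-++⁺ʳ; ∈-map⁺; ∈-map⁻; ∈-filter⁺; ∈-filter⁻; ∈-upTo⁺; ∈-upTo⁻)
import Data.List.Membership.Setoid.Properties as SetoidMembership
open import Data.List.Relation.Unary.Any as Any using (Any; here; there)
open import Data.List.Relation.Unary.All as All using (All; []; _∷_)
open import Data.List.Relation.Unary.AllPairs as AllPairs using (AllPairs; []; _∷_)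
open import Data.List.Relation.Unary.Unique.Propositional using (Unique)
import Data.List.Relation.Unary.Unique.Propositional.Properties as Unique
import Data.List.Relation.Unary.Unique.DecSetoid.Properties as DecUnique
open import Relation.Binary.Bundles using (DecSetoid)
open import Data.Nat.Divisibility using (_∣_; divides; _∣?_; ∣⇒≤; ∣-refl; ∣-antisym)
open import Data.Nat.GCD
  using (gcd; gcd[m,n]∣m; gcd[m,n]∣n; gcd-GCD; gcd-greatest; gcd[m,n]≢0; c*gcd[m,n]≡gcd[cm,cn]; gcd-identityˡ; module Bézout)
open import Data.Nat.Combinatorics using (_C_; nCk≡nC[n∸k]; nCn≡1; nCk+nC[k+1]≡[n+1]C[k+1]; k>n⇒nCk≡0)

-- Burnside's lemma is applied to the 2n parameters `(s , c)`, not to the set of maps they induce: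
-- for n = 1 and n = 2 rotations and reflections coincide, and counting with multiplicity keeps the
-- factor 2n correct. Positions are natural numbers read modulo n, so that `k ↦ c ± k` needs neither
-- subtraction nor bounds. In the induction on ones, the image of `u` is known from the image of `u`
-- without `i` except for one flip at an unknown position; the second route, through `u` without
-- `j`, excludes every wrong position. Rigidity starts at n = 2, since for n = 1 a position is its
-- own neighbour. The case n = 2 needs care only because the steps +1 and -1 agree there. For the
-- reflections the parity of n is never examined. Conjugation by a rotation moves `c` by two, so two
-- consecutive axes always have the same total of fixed strings, and the doubled sum over all axes
-- is n times that total. This total and twice the binomial sum satisfy the same Fibonacci
-- recurrence in steps n to n + 2.

-- Out-of-range positions read as false, so 11-freeness needs no bounds.
get : ∀ {l} → Vec Bool l → ℕ → Bool
get []       _       = false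
get (x ∷ xs) zero    = x
get (x ∷ xs) (suc k) = get xs k

tab : ∀ l → (ℕ → Bool) → Vec Bool l
tab zero    f = []
tab (suc l) f = f 0 ∷ tab l (f ∘ suc)

get-tab : ∀ l f {k} → k < l → get (tab l f) k ≡ f k
get-tab (suc l) f {zero}  _       = refl
get-tab (suc l) f {suc k} (s≤s p) = get-tab l (f ∘ suc) p

get-ext : ∀ {l} (u v : Vec Bool l) → (∀ {k} → k < l → get u k ≡ get v k) → u ≡ v
get-ext []       []       h = refl
get-ext (x ∷ xs) (y ∷ ys) h = cong₂ _∷_ (h (s≤s z≤n)) (get-ext xs ys (h ∘ s≤s))

get-≥ : ∀ {l} (u : Vec Bool l) {k} → l ≤ k → get u k ≡ false
get-≥ []       _       = refl
get-≥ (x ∷ xs) (s≤s p) = get-≥ xs p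

get-last : ∀ {l} (u : Vec Bool (suc l)) → get u l ≡ last u
get-last {zero}  (x ∷ [])     = refl
get-last {suc l} (x ∷ y ∷ xs) = get-last (y ∷ xs)

∧-true : ∀ {a b} → a ∧ b ≡ true → a ≡ true × b ≡ true
∧-true {true} {true} _ = refl , refl

not-true : ∀ {a} → not a ≡ true → a ≡ false
not-true {false} _ = refl

T⇒≡ : ∀ {b} → T b → b ≡ true
T⇒≡ {true} _ = refl

≡⇒T : ∀ {b} → b ≡ true → T b
≡⇒T refl = tt

noConsec⁻ : ∀ {l} (u : Vec Bool l) → noConsec u ≡ true → ∀ k → get u k ∧ get u (suc k) ≡ false
noConsec⁻ []           h k       = refl
noConsec⁻ (x ∷ [])     h zero    = ∧-zeroʳ x
noConsec⁻ (x ∷ [])     h (suc k) = refl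
noConsec⁻ (x ∷ y ∷ xs) h zero    = not-true (proj₁ (∧-true h))
noConsec⁻ (x ∷ y ∷ xs) h (suc k) = noConsec⁻ (y ∷ xs) (proj₂ (∧-true {not (x ∧ y)} h)) k

noConsec⁺ : ∀ {l} (u : Vec Bool l) → (∀ k → get u k ∧ get u (suc k) ≡ false) → noConsec u ≡ true
noConsec⁺ []           h = refl
noConsec⁺ (x ∷ [])     h = refl
noConsec⁺ (x ∷ y ∷ xs) h = cong₂ _∧_ (cong not (h 0)) (noConsec⁺ (y ∷ xs) (h ∘ suc))

-- Congruence modulo m + 1

infix 4 _≡[_]_

-- A record and not an abbreviation, so that unification can recover `a` and `b`, which `%` hides.
record _≡[_]_ (a m b : ℕ) : Set where
  constructor mod
  field %-≡ : a % suc m ≡ b % suc m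

open _≡[_]_

≡[]-refl : ∀ {m a} → a ≡[ m ] a
≡[]-refl = mod refl

≡[]-sym : ∀ {m a b} → a ≡[ m ] b → b ≡[ m ] a
≡[]-sym (mod p) = mod (sym p)

≡[]-trans : ∀ {m a b c} → a ≡[ m ] b → b ≡[ m ] c → a ≡[ m ] c
≡[]-trans (mod p) (mod q) = mod (trans p q)

≡[]-reflexive : ∀ {m a b} → a ≡ b → a ≡[ m ] b
≡[]-reflexive = mod ∘ cong (_% _)

_≡[]?_ : ∀ {m} a b → Dec (a ≡[ m ] b)
a ≡[]? b = Dec.map′ mod %-≡ (a % _ ≟ b % _)

%-≡[] : ∀ {m} a → a % suc m ≡[ m ] a
%-≡[] {m} a = mod (m%n%n≡m%n a (suc m))

mod-intro : ∀ {m a b} x y → a + x * suc m ≡ b + y * suc m → a ≡[ m ] b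
mod-intro {m} {a} {b} x y eq = mod
  (trans (sym ([m+kn]%n≡m%n a x (suc m))) (trans (cong (_% suc m) eq) ([m+kn]%n≡m%n b y (suc m))))

-- The index maps of the dihedral action all have the form `c + t * a`, so this makes the action
-- well defined on residues.
mod-affine : ∀ {m} c t {a b} → a ≡[ m ] b → c + t * a ≡[ m ] c + t * b
mod-affine {m} c t {a} {b} (mod eq) = ≡[]-trans (reduce a)
  (≡[]-trans (≡[]-reflexive (cong (λ z → c + t * z) eq)) (≡[]-sym (reduce b)))
  where
  expand : ∀ c t r q n → c + t * (r + q * n) + 0 * n ≡ c + t * r + t * q * n
  expand = solve-∀
  reduce : ∀ a → c + t * a ≡[ m ] c + t * (a % suc m)
  reduce a = ≡[]-trans (≡[]-reflexive (cong (λ z → c + t * z) (m≡m%n+[m/n]*n a (suc m))))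
    (mod-intro 0 (t * (a / suc m)) (expand c t (a % suc m) (a / suc m) (suc m)))

mod-+ˡ : ∀ {m} c {a b} → a ≡[ m ] b → c + a ≡[ m ] c + b
mod-+ˡ {m} c {a} {b} eq = subst₂ (λ x y → c + x ≡[ m ] c + y) (*-identityˡ a) (*-identityˡ b) (mod-affine c 1 eq)

mod-suc : ∀ {m a b} → a ≡[ m ] b → suc a ≡[ m ] suc b
mod-suc = mod-+ˡ 1

mod-+ʳ : ∀ {m} c {a b} → a ≡[ m ] b → a + c ≡[ m ] b + c
mod-+ʳ {m} c {a} {b} eq = subst₂ (_≡[ m ]_) (+-comm c a) (+-comm c b) (mod-+ˡ c eq)

-- Adding `m` undoes the successor, because `1 + m` vanishes.
mod-suc⁻¹ : ∀ {m a b} → suc a ≡[ m ] suc b → a ≡[ m ] b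
mod-suc⁻¹ {m} {a} {b} eq = ≡[]-trans (add a) (≡[]-trans (mod-+ˡ m eq) (≡[]-sym (add b)))
  where
  expand : ∀ m a → a + 1 * (1 + m) ≡ m + (1 + a) + 0 * (1 + m)
  expand = solve-∀
  add : ∀ a → a ≡[ m ] m + suc a
  add a = mod-intro 1 0 (expand m a)

-- Lucas strings as periodic sequences

at : ∀ {m} → Vec Bool (suc m) → ℕ → Bool
at {m} u k = get u (k % suc m)

at-cong : ∀ {m} (u : Vec Bool (suc m)) {a b} → a ≡[ m ] b → at u a ≡ at u b
at-cong u = cong (get u) ∘ %-≡

at-< : ∀ {m} (u : Vec Bool (suc m)) {k} → k < suc m → at u k ≡ get u k
at-< u p = cong (get u) (m<n⇒m%n≡m p)

at-ext : ∀ {m} (u v : Vec Bool (suc m)) → (∀ k → at u k ≡ at v k) → u ≡ v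
at-ext u v h = get-ext u v λ {k} p → trans (sym (at-< u p)) (trans (h k) (at-< v p))

Periodic : ℕ → (ℕ → Bool) → Set
Periodic m f = ∀ {a b} → a ≡[ m ] b → f a ≡ f b

at-tab : ∀ {m f} → Periodic m f → ∀ k → at (tab (suc m) f) k ≡ f k
at-tab {m} {f} per k = trans (get-tab (suc m) f (m%n<n k (suc m))) (per (%-≡[] k))

Sparse : (ℕ → Bool) → Set
Sparse f = ∀ k → f k ∧ f (suc k) ≡ false

suc-% : ∀ m k → k % suc m < m → suc k % suc m ≡ suc (k % suc m)
suc-% m k p = trans (%-≡ (mod-suc {m} (≡[]-sym (%-≡[] k)))) (m<n⇒m%n≡m (s≤s p))

suc-%-wrap : ∀ m k → k % suc m ≡ m → suc k % suc m ≡ 0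
suc-%-wrap m k p = trans (%-≡ (mod-suc {m} {k} {m} (mod (trans p (sym (m<n⇒m%n≡m ≤-refl)))))) (n%n≡0 (suc m))

-- The clause on head and last concerns the residues `m` and `0`, which are consecutive on the
-- cycle; read periodically, both clauses become one.
isLucas⁻ : ∀ {m} (u : Vec Bool (suc m)) → T (isLucas u) → Sparse (at u)
isLucas⁻ {m} u@(x ∷ xs) h k with ∧-true {noConsec u} (T⇒≡ h) | m≤n⇒m<n∨m≡n (s≤s⁻¹ (m%n<n k (suc m)))
... | nc , _ | inj₁ p rewrite suc-% m k p = noConsec⁻ u nc (k % suc m)
... | _ , hl | inj₂ p rewrite suc-%-wrap m k p | p | get-last u = trans (∧-comm (last u) x) (not-true hl)

isLucas⁺ : ∀ {m} (u : Vec Bool (suc m)) → Sparse (at u) → T (isLucas u)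
isLucas⁺ {m} u@(x ∷ xs) h = ≡⇒T (cong₂ _∧_ (noConsec⁺ u inner) (cong not wrap))
  where
  wrap : x ∧ last u ≡ false
  wrap = trans (∧-comm x (last u)) (subst₂ (λ a b → a ∧ get u b ≡ false)
           (trans (at-< u ≤-refl) (get-last u)) (n%n≡0 (suc m)) (h m))
  inner : ∀ k → get u k ∧ get u (suc k) ≡ false
  inner k with <-≤-connex (suc k) (suc m)
  ... | inj₁ p = subst₂ (λ a b → a ∧ b ≡ false) (at-< u (<⇒≤ p)) (at-< u p) (h k)
  ... | inj₂ p = trans (cong (get u k ∧_) (get-≥ u p)) (∧-zeroʳ _)

V-≡ : ∀ {n} {u v : V n} → proj₁ u ≡ proj₁ v → u ≡ v
V-≡ {u = u , p} {v = .u , q} refl = cong (u ,_) (T-irrelevant p q)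

bit : ∀ {m} → V (suc m) → ℕ → Bool
bit u = at (proj₁ u)

bit-ext : ∀ {m} (u v : V (suc m)) → (∀ k → bit u k ≡ bit v k) → u ≡ v
bit-ext u v h = V-≡ (at-ext (proj₁ u) (proj₁ v) h)

bit-cong : ∀ {m} (u : V (suc m)) {a b} → a ≡[ m ] b → bit u a ≡ bit u b
bit-cong u = at-cong (proj₁ u)

sparse : ∀ {m} (u : V (suc m)) → Sparse (bit u)
sparse u = isLucas⁻ (proj₁ u) (proj₂ u)

abstract
  -- Abstract, so that vertices built from a function are known only through `bit-mkV` and never
  -- unfold to a tabulated vector.
  mkV : ∀ m f → Periodic m f → Sparse f → V (suc m)
  mkV m f per sp = tab (suc m) f , isLucas⁺ (tab (suc m) f) λ k →
    trans (cong₂ _∧_ (at-tab {m} {f} per k) (at-tab {m} {f} per (suc k))) (sp k)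

  bit-mkV : ∀ m f (per : Periodic m f) (sp : Sparse f) k → bit (mkV m f per sp) k ≡ f k
  bit-mkV m f per sp = at-tab {m} {f} per

-- The dihedral action

-- Indices live modulo m + 1, so m stands for −1.
coef : ℕ → Bool → ℕ
coef m true  = 1
coef m false = m

coef² : ∀ m s k → coef m s * (coef m s * k) ≡[ m ] k
coef² m true  k = ≡[]-reflexive (trans (*-identityˡ _) (*-identityˡ k))
coef² m false k = mod-intro k (m * k) (expand m k)
  where
  expand : ∀ m k → m * (m * k) + k * (1 + m) ≡ k + m * k * (1 + m)
  expand = solve-∀

-- `true` is the sign +1, so signs multiply by the negated xor.
coef-* : ∀ m s t k → coef m t * (coef m s * k) ≡[ m ] coef m (not (s xor t)) * k
coef-* m true  true  k = ≡[]-reflexive (*-identityˡ (1 * k))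
coef-* m true  false k = ≡[]-reflexive (cong (m *_) (*-identityˡ k))
coef-* m false true  k = ≡[]-reflexive (*-identityˡ (m * k))
coef-* m false false k = ≡[]-trans (coef² m false k) (≡[]-reflexive (sym (*-identityˡ k)))

sparse-flip : ∀ {m} (u : V (suc m)) {a b} → a ≡[ m ] suc b → bit u a ∧ bit u b ≡ false
sparse-flip u {a} {b} p = trans (∧-comm (bit u a) (bit u b)) (trans (cong (bit u b ∧_) (bit-cong u p)) (sparse u b))

act-sparse : ∀ {m} s c (u : V (suc m)) → Sparse (λ k → bit u (c + coef m s * k))
act-sparse true c u k = trans (cong (λ z → bit u (c + 1 * k) ∧ bit u z) (forward c k)) (sparse u (c + 1 * k))
  where
  forward : ∀ c k → c + 1 * (1 + k) ≡ 1 + (c + 1 * k)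
  forward = solve-∀
act-sparse {m} false c u k = sparse-flip u (mod-intro 1 0 (backward m c k))
  where
  backward : ∀ m c k → c + m * k + 1 * (1 + m) ≡ 1 + (c + m * (1 + k)) + 0 * (1 + m)
  backward = solve-∀

-- The rotations (s = true) and reflections (s = false) of the index cycle: k ↦ c ± k.
act : ∀ {m} → Bool → ℕ → V (suc m) → V (suc m)
act {m} s c u = mkV m (λ k → bit u (c + coef m s * k)) (bit-cong u ∘ mod-affine c (coef m s)) (act-sparse s c u)

bit-act : ∀ {m} s c (u : V (suc m)) k → bit (act s c u) k ≡ bit u (c + coef m s * k)
bit-act {m} s c u = bit-mkV m (λ k → bit u (c + coef m s * k)) (bit-cong u ∘ mod-affine c (coef m s)) (act-sparse s c u)

act-cong : ∀ {m} s {c d} (u : V (suc m)) → c ≡[ m ] d → act s c u ≡ act s d u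
act-cong {m} s {c} {d} u p = bit-ext _ _ λ k →
  trans (bit-act s c u k) (trans (bit-cong u (mod-+ʳ (coef m s * k) p)) (sym (bit-act s d u k)))

-- `act` precomposes, which reverses the order: an index is moved by `(s , c)` first and by
-- `(t , d)` afterwards.
act-act : ∀ {m} s t c d (u : V (suc m)) →
          act s c (act t d u) ≡ act (not (s xor t)) (d + coef m t * c) u
act-act {m} s t c d u = bit-ext _ _ λ k → begin
  bit (act s c (act t d u)) k
    ≡⟨ bit-act s c (act t d u) k ⟩
  bit (act t d u) (c + coef m s * k)
    ≡⟨ bit-act t d u (c + coef m s * k) ⟩
  bit u (d + coef m t * (c + coef m s * k))
    ≡⟨ cong (bit u) (expand d (coef m t) c (coef m s * k)) ⟩
  bit u (d + coef m t * c + coef m t * (coef m s * k))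
    ≡⟨ bit-cong u (mod-+ˡ (d + coef m t * c) (coef-* m s t k)) ⟩
  bit u (d + coef m t * c + coef m (not (s xor t)) * k)
    ≡⟨ bit-act (not (s xor t)) (d + coef m t * c) u k ⟨
  bit (act (not (s xor t)) (d + coef m t * c) u) k ∎
  where
  open ≡-Reasoning
  expand : ∀ d t c k → d + t * (c + k) ≡ d + t * c + t * k
  expand = solve-∀

act-0 : ∀ {m} (u : V (suc m)) → act true 0 u ≡ u
act-0 u = bit-ext _ _ λ k → trans (bit-act true 0 u k) (cong (bit u) (*-identityˡ k))

-- A reflection is its own inverse; for a rotation `c` is negated, with `m` in the role of -1.
inv : ℕ → Bool → ℕ → ℕ
inv m true  c = m * c
inv m false c = c

inv-coef : ∀ m t d → d + coef m t * inv m t d ≡[ m ] 0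
inv-coef m true  d = mod-intro 0 d (expand m d)
  where
  expand : ∀ m d → d + 1 * (m * d) + 0 * (1 + m) ≡ 0 + d * (1 + m)
  expand = solve-∀
inv-coef m false d = mod-intro 0 d (expand m d)
  where
  expand : ∀ m d → d + m * d + 0 * (1 + m) ≡ 0 + d * (1 + m)
  expand = solve-∀

coef-inv : ∀ m t d → inv m t d + coef m t * d ≡[ m ] 0
coef-inv m true  d = ≡[]-trans (≡[]-reflexive (expand m d)) (inv-coef m true d)
  where
  expand : ∀ m d → m * d + 1 * d ≡ d + 1 * (m * d)
  expand = solve-∀
coef-inv m false d = inv-coef m false d

xnor-self : ∀ t → not (t xor t) ≡ true
xnor-self true  = refl
xnor-self false = refl

act-inv : ∀ {m} t d (u : V (suc m)) → act t (inv m t d) (act t d u) ≡ u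
act-inv {m} t d u = trans (act-act t t (inv m t d) d u)
  (trans (cong (λ s → act s (d + coef m t * inv m t d) u) (xnor-self t))
    (trans (act-cong true u (inv-coef m t d)) (act-0 u)))

inv-act : ∀ {m} t d (u : V (suc m)) → act t d (act t (inv m t d) u) ≡ u
inv-act {m} t d u = trans (act-act t t d (inv m t d) u)
  (trans (cong (λ s → act s (inv m t d + coef m t * d) u) (xnor-self t))
    (trans (act-cong true u (coef-inv m t d)) (act-0 u)))

_~_ : ∀ {m} → V (suc m) → V (suc m) → Set
u ~ v = ∃ λ s → ∃ λ c → act s c u ≡ v

~-refl : ∀ {m} {u : V (suc m)} → u ~ u
~-refl {u = u} = true , 0 , act-0 u

~-sym : ∀ {m} {u v : V (suc m)} → u ~ v → v ~ u
~-sym {m} {u} (s , c , refl) = s , inv m s c , act-inv s c u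

~-trans : ∀ {m} {u v w : V (suc m)} → u ~ v → v ~ w → u ~ w
~-trans {m} {u} (s , c , refl) (t , d , refl) = not (t xor s) , c + coef m s * d , sym (act-act t s d c u)

infix 4 _≟ⱽ_
_≟ⱽ_ : ∀ {n} (u v : V n) → Dec (u ≡ v)
u ≟ⱽ v = Dec.map′ V-≡ (cong proj₁) (≡-dec Bool._≟_ (proj₁ u) (proj₁ v))

~-dec : ∀ {m} (u v : V (suc m)) → Dec (u ~ v)
~-dec {m} u v = Dec.map′
  [ (λ (c , _ , p) → true , c , p) , (λ (c , _ , p) → false , c , p) ]′ bound
  (anyUpTo? (λ c → act true c u ≟ⱽ v) (suc m) Dec.⊎-dec anyUpTo? (λ c → act false c u ≟ⱽ v) (suc m))
  where
  Hit : Bool → Set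
  Hit s = ∃ λ c → c < suc m × act s c u ≡ v
  reduce : ∀ s c → act s c u ≡ v → Hit s
  reduce s c p = c % suc m , m%n<n c (suc m) , trans (act-cong s u (%-≡[] c)) p
  bound : u ~ v → Hit true ⊎ Hit false
  bound (true  , c , p) = inj₁ (reduce true c p)
  bound (false , c , p) = inj₂ (reduce false c p)

-- Adjacency

hamming-refl : ∀ {l} (u : Vec Bool l) → hamming u u ≡ 0
hamming-refl []           = refl
hamming-refl (true  ∷ xs) = hamming-refl xs
hamming-refl (false ∷ xs) = hamming-refl xs

hamming≡0 : ∀ {l} (u v : Vec Bool l) → hamming u v ≡ 0 → u ≡ v
hamming≡0 []           []           _ = refl
hamming≡0 (true  ∷ xs) (true  ∷ ys) p = cong (true ∷_) (hamming≡0 xs ys p)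
hamming≡0 (false ∷ xs) (false ∷ ys) p = cong (false ∷_) (hamming≡0 xs ys p)

DiffersAt : ∀ {l} → Vec Bool l → Vec Bool l → ℕ → Set
DiffersAt u v i = ∀ k → get v k ≡ does (k ≟ i) xor get u k

differs-head : ∀ {l} x (xs : Vec Bool l) → DiffersAt (x ∷ xs) (not x ∷ xs) 0
differs-head x xs zero    = refl
differs-head x xs (suc k) = refl

differs-tail : ∀ {l} x {xs ys : Vec Bool l} {i} → DiffersAt xs ys i → DiffersAt (x ∷ xs) (x ∷ ys) (suc i)
differs-tail x h zero    = refl
differs-tail x h (suc k) = h k

hamming⇒ : ∀ {l} (u v : Vec Bool l) → hamming u v ≡ 1 → ∃ λ i → i < l × DiffersAt u v i
hamming⇒ [] [] ()
hamming⇒ (true ∷ xs) (true ∷ ys) p with hamming⇒ xs ys p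
... | i , i<l , d = suc i , s≤s i<l , differs-tail true d
hamming⇒ (false ∷ xs) (false ∷ ys) p with hamming⇒ xs ys p
... | i , i<l , d = suc i , s≤s i<l , differs-tail false d
hamming⇒ (true  ∷ xs) (false ∷ ys) p with refl ← hamming≡0 xs ys (suc-injective p) =
  0 , s≤s z≤n , differs-head true xs
hamming⇒ (false ∷ xs) (true  ∷ ys) p with refl ← hamming≡0 xs ys (suc-injective p) =
  0 , s≤s z≤n , differs-head false xs

hamming⇐ : ∀ {l} (u v : Vec Bool l) i → i < l → DiffersAt u v i → hamming u v ≡ 1
hamming⇐ (x ∷ xs) (y ∷ ys) zero _ d with refl ← d 0 | refl ← get-ext ys xs (λ {k} _ → d (suc k)) =
  head-differs x
  where
  head-differs : ∀ x → hamming (x ∷ xs) (not x ∷ xs) ≡ 1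
  head-differs true  = cong suc (hamming-refl xs)
  head-differs false = cong suc (hamming-refl xs)
hamming⇐ (x ∷ xs) (y ∷ ys) (suc i) (s≤s p) d with refl ← d 0 = head-agrees x
  where
  head-agrees : ∀ x → hamming (x ∷ xs) (x ∷ ys) ≡ 1
  head-agrees true  = hamming⇐ xs ys i p (d ∘ suc)
  head-agrees false = hamming⇐ xs ys i p (d ∘ suc)

abstract
  δ : ℕ → ℕ → ℕ → Bool
  δ m i k = does (_≡[]?_ {m} k i)

  δ-≟ : ∀ m i k → δ m i k ≡ does (k % suc m ≟ i % suc m)
  δ-≟ m i k = refl

  δ-yes : ∀ {m i k} → k ≡[ m ] i → δ m i k ≡ true
  δ-yes {m} {i} {k} = Dec.dec-true (_≡[]?_ {m} k i)

  δ-no : ∀ {m i k} → ¬ k ≡[ m ] i → δ m i k ≡ false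
  δ-no {m} {i} {k} = Dec.dec-false (_≡[]?_ {m} k i)

Near : ∀ {m} → V (suc m) → V (suc m) → ℕ → Set
Near {m} u v i = ∀ k → bit v k ≡ δ m i k xor bit u k

Adj⇒Near : ∀ {m} {u v : V (suc m)} → Adj u v → ∃ (Near u v)
Adj⇒Near {m} {u} {v} p with hamming⇒ (proj₁ u) (proj₁ v) p
... | i , i<n , d = i , λ k → trans (d (k % suc m)) (cong (_xor bit u k)
  (trans (cong (λ j → does (k % suc m ≟ j)) (sym (m<n⇒m%n≡m i<n))) (sym (δ-≟ m i k))))

Near⇒Adj : ∀ {m} {u v : V (suc m)} i → Near u v i → Adj u v
Near⇒Adj {m} {u} {v} i h = hamming⇐ (proj₁ u) (proj₁ v) (i % suc m) (m%n<n i (suc m)) pointwise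
  where
  pointwise : DiffersAt (proj₁ u) (proj₁ v) (i % suc m)
  pointwise k with <-≤-connex k (suc m)
  ... | inj₁ p = subst (λ j → get (proj₁ v) j ≡ does (j ≟ i % suc m) xor get (proj₁ u) j) (m<n⇒m%n≡m p)
               (trans (h k) (cong (_xor bit u k) (δ-≟ m i k)))
  ... | inj₂ p = trans (get-≥ (proj₁ v) p) (sym (cong₂ _xor_ (Dec.dec-false (k ≟ i % suc m) beyond) (get-≥ (proj₁ u) p)))
    where
    beyond : k ≢ i % suc m
    beyond refl = contradiction (m%n<n i (suc m)) (≤⇒≯ p)

δ-true : ∀ {m i k} → δ m i k ≡ true → k ≡[ m ] i
δ-true {m} {i} {k} h = Dec.decidable-stable (_≡[]?_ {m} k i) λ ¬p → contradiction (trans (sym h) (δ-no ¬p)) λ ()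

δ-⇔ : ∀ {m i k j l} → (k ≡[ m ] i → l ≡[ m ] j) → (l ≡[ m ] j → k ≡[ m ] i) → δ m i k ≡ δ m j l
δ-⇔ {m} {i} {k} f g with _≡[]?_ {m} k i
... | yes p = trans (δ-yes p) (sym (δ-yes (f p)))
... | no ¬p = trans (δ-no ¬p) (sym (δ-no (¬p ∘ g)))

act-inverseʳ : ∀ m s c k → c + coef m s * (inv m s c + coef m s * k) ≡[ m ] k
act-inverseʳ m s c k = ≡[]-trans (≡[]-reflexive (expand c (coef m s) (inv m s c) k))
  (≡[]-trans (mod-+ʳ (coef m s * (coef m s * k)) (inv-coef m s c)) (coef² m s k))
  where
  expand : ∀ c t d k → c + t * (d + t * k) ≡ c + t * d + t * (t * k)
  expand = solve-∀

act-inverseˡ : ∀ m s c k → inv m s c + coef m s * (c + coef m s * k) ≡[ m ] k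
act-inverseˡ m s c k = ≡[]-trans (≡[]-reflexive (expand c (coef m s) (inv m s c) k))
  (≡[]-trans (mod-+ʳ (coef m s * (coef m s * k)) (coef-inv m s c)) (coef² m s k))
  where
  expand : ∀ c t d k → d + t * (c + t * k) ≡ d + t * c + t * (t * k)
  expand = solve-∀

-- Bits are pulled back along the index map, so the flipped position moves by the inverse map.
act-Near : ∀ {m} s c {u v : V (suc m)} i → Near u v i →
           Near (act s c u) (act s c v) (inv m s c + coef m s * i)
act-Near {m} s c {u} {v} i h k = begin
  bit (act s c v) k
    ≡⟨ bit-act s c v k ⟩
  bit v (c + coef m s * k)
    ≡⟨ h (c + coef m s * k) ⟩
  δ m i (c + coef m s * k) xor bit u (c + coef m s * k)
    ≡⟨ cong₂ _xor_ (δ-⇔ forth back) (sym (bit-act s c u k)) ⟩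
  δ m (inv m s c + coef m s * i) k xor bit (act s c u) k ∎
  where
  open ≡-Reasoning
  forth : c + coef m s * k ≡[ m ] i → k ≡[ m ] inv m s c + coef m s * i
  forth p = ≡[]-trans (≡[]-sym (act-inverseˡ m s c k)) (mod-affine (inv m s c) (coef m s) p)
  back : k ≡[ m ] inv m s c + coef m s * i → c + coef m s * k ≡[ m ] i
  back p = ≡[]-trans (mod-affine c (coef m s) p) (act-inverseʳ m s c i)

act-Adj : ∀ {m} s c {u v : V (suc m)} → Adj u v → Adj (act s c u) (act s c v)
act-Adj {m} s c {u} {v} p with Adj⇒Near {u = u} {v} p
... | i , h = Near⇒Adj {u = act s c u} {act s c v} (inv m s c + coef m s * i) (act-Near s c {u} {v} i h)

actAut : ∀ {m} → Bool → ℕ → Aut (suc m)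
actAut {m} s c = record
  { f   = act s c
  ; g   = act s (inv m s c)
  ; gf  = act-inv s c
  ; fg  = inv-act s c
  ; adj = λ u v → mk⇔ (act-Adj s c {u} {v}) λ p → subst₂ Adj (act-inv s c u) (act-inv s c v)
            (act-Adj s (inv m s c) {act s c u} {act s c v} p)
  }

~⇒SameOrbit : ∀ {m} {u v : V (suc m)} → u ~ v → SameOrbit u v
~⇒SameOrbit (s , c , p) = actAut s c , p

¬true⇒false : ∀ {b} → (b ≡ true → ⊥) → b ≡ false
¬true⇒false {false} _ = refl
¬true⇒false {true}  h = ⊥-elim (h refl)

∨-true : ∀ {a b} → a ∨ b ≡ true → a ≡ true ⊎ b ≡ true
∨-true {true}  _ = inj₁ refl
∨-true {false} p = inj₂ p

-- With at least two residues no position is its own neighbour, so strings with a single one are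
-- Lucas strings.
suc-≢ : ∀ {m} a → ¬ a ≡[ suc m ] suc a
suc-≢ zero    (mod ())
suc-≢ (suc a) p = suc-≢ a (mod-suc⁻¹ p)

-- Cancelling `a` leaves 2 ≡ 0, so the cycle has at most two positions and the steps +1 and -1
-- agree. This settles the cases of `ascending` and `descending` in which the position map would
-- turn back.
2-cycle : ∀ {m} a → suc (suc a) ≡[ m ] a → ∀ x → suc (suc x) ≡[ m ] x
2-cycle zero    p x = mod-+ʳ x p
2-cycle (suc a) p x = 2-cycle a (mod-suc⁻¹ p) x

δ-periodic : ∀ {m} i → Periodic m (δ m i)
δ-periodic i p = δ-⇔ (≡[]-trans (≡[]-sym p)) (≡[]-trans p)

δ-ext : ∀ {m} {i j} → (∀ k → δ m i k ≡ δ m j k) → i ≡[ m ] j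
δ-ext {m} {i} h = δ-true (trans (sym (h i)) (δ-yes ≡[]-refl))

-- Automorphisms preserve dihedral orbits

origin : ∀ m → V (suc m)
origin m = mkV m (λ _ → false) (λ _ → refl) (λ _ → refl)

bit-origin : ∀ {m} k → bit (origin m) k ≡ false
bit-origin {m} = bit-mkV m (λ _ → false) (λ _ → refl) (λ _ → refl)

NonAdjacent : ℕ → ℕ → ℕ → Set
NonAdjacent m i j = ¬ j ≡[ m ] suc i × ¬ i ≡[ m ] suc j

pair-periodic : ∀ {m} i j → Periodic m (λ k → δ m i k ∨ δ m j k)
pair-periodic i j p = cong₂ _∨_ (δ-periodic i p) (δ-periodic j p)

pair-sparse : ∀ {m} i j → NonAdjacent (suc m) i j → Sparse (λ k → δ (suc m) i k ∨ δ (suc m) j k)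
pair-sparse {m} i j (p , q) k = ¬true⇒false λ h →
  clash (∨-true (proj₁ (∧-true h))) (∨-true (proj₂ (∧-true {δ (suc m) i k ∨ δ (suc m) j k} h)))
  where
  clash : δ (suc m) i k ≡ true ⊎ δ (suc m) j k ≡ true → δ (suc m) i (suc k) ≡ true ⊎ δ (suc m) j (suc k) ≡ true → ⊥
  clash (inj₁ a) (inj₁ b) = suc-≢ i (≡[]-trans (≡[]-sym (δ-true b)) (mod-suc (δ-true a)))
  clash (inj₁ a) (inj₂ b) = p (≡[]-trans (≡[]-sym (δ-true b)) (mod-suc (δ-true a)))
  clash (inj₂ a) (inj₁ b) = q (≡[]-trans (≡[]-sym (δ-true b)) (mod-suc (δ-true a)))
  clash (inj₂ a) (inj₂ b) = suc-≢ j (≡[]-trans (≡[]-sym (δ-true b)) (mod-suc (δ-true a)))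

pair : ∀ {m} i j → NonAdjacent (suc m) i j → V (suc (suc m))
pair {m} i j na = mkV (suc m) (λ k → δ (suc m) i k ∨ δ (suc m) j k) (pair-periodic i j) (pair-sparse i j na)

bit-pair : ∀ {m} i j (na : NonAdjacent (suc m) i j) k → bit (pair i j na) k ≡ δ (suc m) i k ∨ δ (suc m) j k
bit-pair {m} i j na = bit-mkV (suc m) (λ k → δ (suc m) i k ∨ δ (suc m) j k) (pair-periodic i j) (pair-sparse i j na)

single : ∀ {m} → ℕ → V (suc (suc m))
single i = pair i i (suc-≢ i , suc-≢ i)

bit-single : ∀ {m} i k → bit (single {m} i) k ≡ δ (suc m) i k
bit-single {m} i k = trans (bit-pair i i (suc-≢ i , suc-≢ i) k) (Bool.∨-idem (δ (suc m) i k))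

single-Near : ∀ {m} i → Near (origin (suc m)) (single i) i
single-Near {m} i k = trans (bit-single i k) (sym (trans (cong (δ (suc m) i k xor_) (bit-origin k)) (Bool.xor-identityʳ _)))

clear-periodic : ∀ {m} (u : V (suc m)) i → Periodic m (λ k → not (δ m i k) ∧ bit u k)
clear-periodic u i p = cong₂ (λ a b → not a ∧ b) (δ-periodic i p) (bit-cong u p)

clear-sparse : ∀ {m} (u : V (suc m)) i → Sparse (λ k → not (δ m i k) ∧ bit u k)
clear-sparse {m} u i k = sp (δ m i k) (δ m i (suc k)) (sparse u k)
  where
  sp : ∀ x y {a b} → a ∧ b ≡ false → (not x ∧ a) ∧ (not y ∧ b) ≡ false
  sp true  y     h = refl
  sp false true  {a} h = ∧-zeroʳ a
  sp false false h = h

clear : ∀ {m} → V (suc m) → ℕ → V (suc m)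
clear {m} u i = mkV m (λ k → not (δ m i k) ∧ bit u k) (clear-periodic u i) (clear-sparse u i)

bit-clear : ∀ {m} (u : V (suc m)) i k → bit (clear u i) k ≡ not (δ m i k) ∧ bit u k
bit-clear {m} u i = bit-mkV m (λ k → not (δ m i k) ∧ bit u k) (clear-periodic u i) (clear-sparse u i)

bit-clear-self : ∀ {m} (u : V (suc m)) i → bit (clear u i) i ≡ false
bit-clear-self {m} u i = trans (bit-clear u i i) (cong (λ b → not b ∧ bit u i) (δ-yes {m} {i} ≡[]-refl))

bit-clear-≤ : ∀ {m} (u : V (suc m)) i k → bit (clear u i) k ≡ true → bit u k ≡ true
bit-clear-≤ {m} u i k h = proj₂ (∧-true {not (δ m i k)} (trans (sym (bit-clear u i k)) h))

bit-clear-≢ : ∀ {m} (u : V (suc m)) i {k} → ¬ k ≡[ m ] i → bit (clear u i) k ≡ bit u k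
bit-clear-≢ {m} u i {k} p = trans (bit-clear u i k) (cong (λ b → not b ∧ bit u k) (δ-no {m} {i} p))

clear-Near : ∀ {m} (u : V (suc m)) i → bit u i ≡ true → Near (clear u i) u i
clear-Near {m} u i h k with _≡[]?_ {m} k i
... | yes p = trans (bit-cong u p) (trans h
    (sym (cong₂ _xor_ (δ-yes p) (trans (bit-cong (clear u i) p) (bit-clear-self u i)))))
... | no ¬p = sym (cong₂ _xor_ (δ-no ¬p) (bit-clear-≢ u i ¬p))

Near-sym : ∀ {m} (u v : V (suc m)) i → Near u v i → Near v u i
Near-sym {m} u v i h k = trans (cancel (δ m i k) (bit u k)) (cong (δ m i k xor_) (sym (h k)))
  where
  cancel : ∀ x y → y ≡ x xor (x xor y)
  cancel true  y = sym (Bool.not-involutive y)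
  cancel false y = refl

weight : ∀ {l} → Vec Bool l → ℕ
weight []       = 0
weight (x ∷ xs) = (if x then 1 else 0) + weight xs

weight-mono : ∀ {l} (u v : Vec Bool l) → (∀ k → get v k ≡ true → get u k ≡ true) → weight v ≤ weight u
weight-mono []           []           h = z≤n
weight-mono (x ∷ xs)     (false ∷ ys) h = ≤-trans (weight-mono xs ys (h ∘ suc)) (m≤n+m _ _)
weight-mono (x ∷ xs)     (true ∷ ys)  h with refl ← h 0 refl = s≤s (weight-mono xs ys (h ∘ suc))

weight-< : ∀ {l} (u v : Vec Bool l) i → get u i ≡ true → get v i ≡ false →
           (∀ k → get v k ≡ true → get u k ≡ true) → weight v < weight u
weight-< (true ∷ xs) (false ∷ ys) zero    p q h = s≤s (weight-mono xs ys (h ∘ suc))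
weight-< (x ∷ xs)    (false ∷ ys) (suc i) p q h = ≤-trans (weight-< xs ys i p q (h ∘ suc)) (m≤n+m _ _)
weight-< (x ∷ xs)    (true ∷ ys)  (suc i) p q h with refl ← h 0 refl = s≤s (weight-< xs ys i p q (h ∘ suc))

weight-clear : ∀ {m} (u : V (suc m)) i → bit u i ≡ true → weight (proj₁ (clear u i)) < weight (proj₁ u)
weight-clear {m} u i h = weight-< (proj₁ u) (proj₁ (clear u i)) (i % suc m) h (bit-clear-self u i) below
  where
  below : ∀ k → get (proj₁ (clear u i)) k ≡ true → get (proj₁ u) k ≡ true
  below k p with <-≤-connex k (suc m)
  ... | inj₁ q = trans (sym (at-< (proj₁ u) q)) (bit-clear-≤ u i k (trans (at-< (proj₁ (clear u i)) q) p))
  ... | inj₂ q = contradiction (trans (sym p) (get-≥ (proj₁ (clear u i)) q)) λ ()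

find-one : ∀ {m} (u : V (suc m)) → (∃ λ i → bit u i ≡ true) ⊎ (∀ k → bit u k ≡ false)
find-one {m} u with anyUpTo? (λ i → bit u i Bool.≟ true) (suc m)
... | yes (i , _ , p) = inj₁ (i , p)
... | no none = inj₂ λ k → trans (sym (bit-cong u {k % suc m} {k} (%-≡[] k)))
                  (¬true⇒false λ h → none (k % suc m , m%n<n k (suc m) , h))

inverse : ∀ {n} → Aut n → Aut n
inverse σ = record
  { f = g ; g = f ; gf = fg ; fg = gf
  ; adj = λ x y → mk⇔ (λ p → Equivalence.from (adj (g x) (g y)) (subst₂ Adj (sym (fg x)) (sym (fg y)) p))
                      (λ p → subst₂ Adj (fg x) (fg y) (Equivalence.to (adj (g x) (g y)) p))
  }
  where open Aut σ

-- The zero string is fixed and the single ones are permuted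

module Positions {m : ℕ} (σ : Aut (suc (suc m))) where
  open Aut σ

  f-injective : ∀ {u v} → f u ≡ f v → u ≡ v
  f-injective {u} {v} p = trans (sym (gf u)) (trans (cong g p) (gf v))

  f-Near : ∀ {u v} i → Near u v i → ∃ (Near (f u) (f v))
  f-Near {u} {v} i h = Adj⇒Near {u = f u} {f v} (Equivalence.to (adj u v) (Near⇒Adj {u = u} {v} i h))

  abstract
    -- At this stage `f` is not known to fix the origin, so `π i` is only the position in which
    -- `f (single i)` departs from the image of the origin.
    π : ℕ → ℕ
    π i = proj₁ (f-Near {origin (suc m)} {single i} i (single-Near i))

    π-Near : ∀ i → Near (f (origin (suc m))) (f (single i)) (π i)
    π-Near i = proj₂ (f-Near {origin (suc m)} {single i} i (single-Near i))

  -- Flipping the same position of `f (origin (suc m))` gives the same vertex, and `f` separates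
  -- distinct singles.
  π-injective : ∀ {i j} → π i ≡[ suc m ] π j → i ≡[ suc m ] j
  π-injective {i} {j} p = δ-ext λ k → trans (sym (bit-single i k))
    (trans (cong (λ u → bit u k) (f-injective {single i} {single j} (bit-ext _ _ same))) (bit-single j k))
    where
    same : ∀ k → bit (f (single i)) k ≡ bit (f (single j)) k
    same k = trans (π-Near i k) (trans (cong (_xor bit (f (origin (suc m))) k)
      (δ-⇔ (λ q → ≡[]-trans q p) (λ q → ≡[]-trans q (≡[]-sym p)))) (sym (π-Near j k)))

  -- The origin has degree n, while next to a vertex with a one at i the flip at i + 1 is not available.
  f-origin : ∀ i → bit (f (origin (suc m))) i ≡ false
  f-origin i = ¬true⇒false λ h → collision (avoid h)
    where
    avoid : bit (f (origin (suc m))) i ≡ true → ∀ j → ¬ π j ≡[ suc m ] suc i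
    avoid h j p = contradiction (trans (sym (cong₂ _∧_ at-i at-suc)) (sparse (f (single j)) i)) λ ()
      where
      at-suc : bit (f (single j)) (suc i) ≡ true
      at-suc = trans (π-Near j (suc i)) (cong₂ _xor_ (δ-yes (≡[]-sym p))
        (trans (cong (_∧ bit (f (origin (suc m))) (suc i)) (sym h)) (sparse (f (origin (suc m))) i)))
      at-i : bit (f (single j)) i ≡ true
      at-i = trans (π-Near j i) (cong₂ _xor_ (δ-no λ q → suc-≢ i (≡[]-trans q p)) h)
    residue : ℕ → Fin (suc (suc m))
    residue k = fromℕ< (m%n<n k (suc (suc m)))
    residue-≡ : ∀ {a b} → residue a ≡ residue b → a ≡[ suc m ] b
    residue-≡ p = mod (trans (sym (toℕ-fromℕ< _)) (trans (cong toℕ p) (toℕ-fromℕ< _)))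
    -- Missing the residue of `suc i`, the injective `π` would embed n residues into n - 1:
    -- `punchOut` removes the missed residue and the pigeonhole principle applies.
    collision : (∀ j → ¬ π j ≡[ suc m ] suc i) → ⊥
    collision av = Fin.<⇒≢ j<j′ (Fin.toℕ-injective (trans (sym (m<n⇒m%n≡m (toℕ<n j)))
        (trans (%-≡ (π-injective (residue-≡ (punchOut-injective (missed j) (missed j′) same)))) (m<n⇒m%n≡m (toℕ<n j′)))))
      where
      missed : ∀ (j : Fin (suc (suc m))) → residue (suc i) ≢ residue (π (toℕ j))
      missed j p = av (toℕ j) (≡[]-sym (residue-≡ p))
      hit = pigeonhole (n<1+n (suc m)) (λ j → punchOut (missed j))
      j = proj₁ hit
      j′ = proj₁ (proj₂ hit)
      j<j′ = proj₁ (proj₂ (proj₂ hit))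
      same = proj₂ (proj₂ (proj₂ hit))

  f-single : ∀ i k → bit (f (single i)) k ≡ δ (suc m) (π i) k
  f-single i k = trans (π-Near i k) (trans (cong (δ (suc m) (π i) k xor_) (f-origin k)) (Bool.xor-identityʳ _))

-- The permutation of positions determines the images of all strings

module Rigidity {m : ℕ} (σ : Aut (suc (suc m))) where
  open Aut σ
  open Positions σ
  private module Inv = Positions (inverse σ)
  open Inv using () renaming (π to π⁻¹)

  -- With the origin fixed, `f` sends `single i` to `single (π i)`, and `g` sends it back.
  π⁻¹-π : ∀ i → π⁻¹ (π i) ≡[ suc m ] i
  π⁻¹-π i = δ-ext λ k → trans (sym (Inv.f-single (π i) k)) (trans (cong (λ u → bit u k) image) (bit-single i k))
    where
    image : g (single (π i)) ≡ single i
    image = trans (cong g (bit-ext _ _ λ k → trans (bit-single (π i) k) (sym (f-single i k)))) (gf (single i))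

  -- `π` is chosen for numbers, not residues, so compatibility with congruence has to be won from
  -- the injectivity of `π⁻¹`.
  π-cong : ∀ {i j} → i ≡[ suc m ] j → π i ≡[ suc m ] π j
  π-cong {i} {j} p = Inv.π-injective (≡[]-trans (π⁻¹-π i) (≡[]-trans p (≡[]-sym (π⁻¹-π j))))

  π-π⁻¹ : ∀ i → π (π⁻¹ i) ≡[ suc m ] i
  π-π⁻¹ i = Inv.π-injective (π⁻¹-π (π⁻¹ i))

  δ-π : ∀ a k → δ (suc m) a (π k) ≡ δ (suc m) (π⁻¹ a) k
  δ-π a k = δ-⇔ (λ p → π-injective (≡[]-trans p (≡[]-sym (π-π⁻¹ a)))) (λ p → ≡[]-trans (π-cong p) (π-π⁻¹ a))

  -- The image of `clear u i` being known by induction, the image of `u` is known up to the position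
  -- `a` of one flip, here pulled back along `π`.
  from-clear : ∀ u i a → Near (f (clear u i)) (f u) a → (∀ k → bit (f (clear u i)) (π k) ≡ bit (clear u i) k) →
               ∀ k → bit (f u) (π k) ≡ δ (suc m) (π⁻¹ a) k xor bit (clear u i) k
  from-clear u i a near ih k = trans (near (π k)) (cong₂ _xor_ (δ-π a k) (ih k))

  -- A vertex with ones at i ≠ j is the only common neighbour, besides u without both ones,
  -- of u without i and u without j.
  permutes-within : ∀ w u → weight (proj₁ u) < w → ∀ k → bit (f u) (π k) ≡ bit u k
  permutes-within (suc w) u (s≤s u≤w) with find-one u
  ... | inj₂ none = λ k → trans (cong (λ v → bit (f v) (π k)) u≡origin) (trans (f-origin (π k)) (sym (none k)))
    where
    u≡origin : u ≡ origin (suc m)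
    u≡origin = bit-ext _ _ λ k → trans (none k) (sym (bit-origin k))
  ... | inj₁ (i , ui) with find-one (clear u i)
  ...   | inj₂ none = λ k → begin
    bit (f u) (π k)          ≡⟨ cong (λ v → bit (f v) (π k)) u≡single ⟩
    bit (f (single i)) (π k) ≡⟨ f-single i (π k) ⟩
    δ (suc m) (π i) (π k)            ≡⟨ δ-⇔ π-injective π-cong ⟩
    δ (suc m) i k                    ≡⟨ bit-single i k ⟨
    bit (single i) k         ≡⟨ cong (λ v → bit v k) u≡single ⟨
    bit u k                  ∎
    where
    open ≡-Reasoning
    u≡single : u ≡ single i
    u≡single = bit-ext _ _ λ k → trans (clear-Near u i ui k)
      (trans (cong (δ (suc m) i k xor_) (none k)) (trans (Bool.xor-identityʳ _) (sym (bit-single i k))))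
  ...   | inj₁ (j , uj) with f-Near {clear u i} {u} i (clear-Near u i ui)
                           | f-Near {clear u j} {u} j (clear-Near u j (bit-clear-≤ u i j uj))
  ...     | a , near-a | b , near-b with _≡[]?_ {suc m} (π⁻¹ a) i
  ...       | yes p = λ k → trans (via-i k) (trans (cong (_xor bit (clear u i) k)
                        (δ-⇔ (λ q → ≡[]-trans q p) (λ q → ≡[]-trans q (≡[]-sym p)))) (sym (clear-Near u i ui k)))
    where
    via-i = from-clear u i a near-a (permutes-within w (clear u i) (≤-trans (weight-clear u i ui) u≤w))
  ...       | no ¬p = contradiction
      (trans (sym ui) (trans (cong (λ v → bit v i) (f-injective fu≡fu′)) (bit-clear-self (clear u j) i))) λ ()
    where
    uj′ : bit u j ≡ true
    uj′ = bit-clear-≤ u i j uj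
    i≢j : ¬ i ≡[ suc m ] j
    i≢j q = contradiction (trans (sym uj) (trans (bit-cong (clear u i) (≡[]-sym q)) (bit-clear-self u i))) λ ()
    clear-ji : bit (clear u j) i ≡ true
    clear-ji = trans (bit-clear-≢ u j i≢j) ui
    via-i = from-clear u i a near-a (permutes-within w (clear u i) (≤-trans (weight-clear u i ui) u≤w))
    via-j = from-clear u j b near-b (permutes-within w (clear u j) (≤-trans (weight-clear u j uj′) u≤w))
    -- At `π i` the route through `clear u i` yields a zero of `f u`, while the image of `clear u j`
    -- has a one there; so the flip of the second route must occur at `π i`.
    b≡i : i ≡[ suc m ] π⁻¹ b
    b≡i = δ-true (Bool.not-injective (trans (sym (Bool.xor-comm (δ (suc m) (π⁻¹ b) i) true))
      (trans (cong (δ (suc m) (π⁻¹ b) i xor_) (sym clear-ji)) (trans (sym (via-j i))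
        (trans (via-i i) (cong₂ _xor_ (δ-no (¬p ∘ ≡[]-sym)) (bit-clear-self u i)))))))
    -- That flip erases the one at `π i`, which makes `f u` the image of `u` with both ones cleared;
    -- injectivity of `f` then contradicts `ui`.
    fu≡fu′ : f u ≡ f (clear (clear u j) i)
    fu≡fu′ = bit-ext _ _ λ x → trans (bit-cong (f u) (≡[]-sym (π-π⁻¹ x)))
      (trans (images (π⁻¹ x)) (bit-cong (f (clear (clear u j) i)) (π-π⁻¹ x)))
      where
      images : ∀ k → bit (f u) (π k) ≡ bit (f (clear (clear u j) i)) (π k)
      images k = trans (via-j k) (trans (cong (_xor bit (clear u j) k)
        (δ-⇔ (λ q → ≡[]-trans q (≡[]-sym b≡i)) (λ q → ≡[]-trans q b≡i)))
        (trans (sym (Near-sym (clear (clear u j) i) (clear u j) i (clear-Near (clear u j) i clear-ji) k))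
          (sym (permutes-within w (clear (clear u j) i)
            (≤-trans (weight-clear (clear u j) i clear-ji) (≤-trans (<⇒≤ (weight-clear u j uj′)) u≤w)) k))))

  permutes : ∀ u k → bit (f u) (π k) ≡ bit u k
  permutes u = permutes-within (suc (weight (proj₁ u))) u ≤-refl

-- The permutation of positions is a symmetry of the cycle

module _ {m : ℕ} (σ : Aut (suc (suc m))) where
  open Aut σ
  open Positions σ
  open Rigidity σ

  -- If the two images were not neighbours, `pair` would put ones on both of them, and the preimage
  -- of this vertex would carry the consecutive ones `k` and `suc k`.
  π-step : ∀ k → π (suc k) ≡[ suc m ] suc (π k) ⊎ π k ≡[ suc m ] suc (π (suc k))
  π-step k with π (suc k) ≡[]? suc (π k) | π k ≡[]? suc (π (suc k))
  ... | yes p | _     = inj₁ p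
  ... | no _  | yes q = inj₂ q
  ... | no ¬p | no ¬q = contradiction
      (trans (sym (cong₂ _∧_ at-k at-suc)) (sparse (g w) k)) λ ()
    where
    w = pair (π k) (π (suc k)) (¬p , ¬q)
    at-k : bit (g w) k ≡ true
    at-k = trans (sym (permutes (g w) k)) (trans (cong (λ v → bit v (π k)) (fg w))
      (trans (bit-pair (π k) (π (suc k)) (¬p , ¬q) (π k)) (cong (_∨ δ (suc m) (π (suc k)) (π k)) (δ-yes {i = π k} ≡[]-refl))))
    at-suc : bit (g w) (suc k) ≡ true
    at-suc = trans (sym (permutes (g w) (suc k))) (trans (cong (λ v → bit v (π (suc k))) (fg w))
      (trans (bit-pair (π k) (π (suc k)) (¬p , ¬q) (π (suc k)))
        (trans (cong (δ (suc m) (π k) (π (suc k)) ∨_) (δ-yes {i = π (suc k)} ≡[]-refl)) (Bool.∨-zeroʳ _))))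

  -- Turning back would give `π (2 + k)` ≡ `π k`, hence `2 + k` ≡ `k` by injectivity, and on so
  -- short a cycle down is also up.
  ascending : π 1 ≡[ suc m ] suc (π 0) → ∀ k → π (suc k) ≡[ suc m ] suc (π k)
  ascending h zero = h
  ascending h (suc k) with π-step (suc k)
  ... | inj₁ p = p
  ... | inj₂ q = ≡[]-trans back
    (≡[]-trans (≡[]-sym (2-cycle k (π-injective back) (π k))) (mod-suc (≡[]-sym (ascending h k))))
    where
    back : π (suc (suc k)) ≡[ suc m ] π k
    back = mod-suc⁻¹ (≡[]-trans (≡[]-sym q) (ascending h k))

  descending : π 0 ≡[ suc m ] suc (π 1) → ∀ k → π k ≡[ suc m ] suc (π (suc k))
  descending h zero = h
  descending h (suc k) with π-step (suc k)
  ... | inj₂ q = q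
  ... | inj₁ p = ≡[]-sym (≡[]-trans (mod-suc back)
    (≡[]-trans (mod-suc (descending h k)) (2-cycle k (π-injective back) (π (suc k)))))
    where
    back : π (suc (suc k)) ≡[ suc m ] π k
    back = ≡[]-trans p (≡[]-sym (descending h k))

  π-affine : ∃ λ s → ∀ k → π k ≡[ suc m ] π 0 + coef (suc m) s * k
  π-affine with π-step 0
  ... | inj₁ h = true , up
    where
    next : ∀ c k → 1 + (c + 1 * k) ≡ c + 1 * (1 + k)
    next = solve-∀
    up : ∀ k → π k ≡[ suc m ] π 0 + 1 * k
    up zero    = ≡[]-reflexive (sym (+-identityʳ (π 0)))
    up (suc k) = ≡[]-trans (ascending h k) (≡[]-trans (mod-suc (up k)) (≡[]-reflexive (next (π 0) k)))
  ... | inj₂ h = false , down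
    where
    start : ∀ m c → c ≡ c + m * 0
    start = solve-∀
    next : ∀ m c k → 1 + (c + m * (1 + k)) + 0 * (1 + m) ≡ c + m * k + 1 * (1 + m)
    next = solve-∀
    down : ∀ k → π k ≡[ suc m ] π 0 + suc m * k
    down zero    = ≡[]-reflexive (start (suc m) (π 0))
    down (suc k) = mod-suc⁻¹ (≡[]-trans (≡[]-sym (descending h k))
      (≡[]-trans (down k) (≡[]-sym (mod-intro 0 1 (next (suc m) (π 0) k)))))

  f-~ : ∀ u → f u ~ u
  f-~ u with π-affine
  ... | s , h = s , π 0 , bit-ext (act s (π 0) (f u)) u λ k →
    trans (bit-act s (π 0) (f u) k)
      (trans (bit-cong (f u) {π 0 + coef (suc m) s * k} {π k} (≡[]-sym (h k))) (permutes u k))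

-- The first and last letter are the same one, which rules out the string with a one.
V₁-unique : (u v : V 1) → u ≡ v
V₁-unique (false ∷ [] , _) (false ∷ [] , _) = refl

SameOrbit⇒~ : ∀ {m} {u v : V (suc m)} → SameOrbit u v → u ~ v
SameOrbit⇒~ {zero}  {u} {v} _ = true , 0 , V₁-unique _ v
SameOrbit⇒~ {suc m} {u} (σ , refl) = ~-sym (f-~ σ u)

-- Finite sums

+-interchange : ∀ a b c d → a + b + (c + d) ≡ a + c + (b + d)
+-interchange = solve-∀

-- The Iverson bracket, which turns cardinalities into sums whose order can be exchanged.
⟦_⟧ : ∀ {a} {A : Set a} → Dec A → ℕ
⟦ d ⟧ = if does d then 1 else 0

⟦⟧-yes : ∀ {a} {A : Set a} (d : Dec A) → A → ⟦ d ⟧ ≡ 1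
⟦⟧-yes d x = cong (if_then 1 else 0) (Dec.dec-true d x)

⟦⟧-no : ∀ {a} {A : Set a} (d : Dec A) → ¬ A → ⟦ d ⟧ ≡ 0
⟦⟧-no d ¬x = cong (if_then 1 else 0) (Dec.dec-false d ¬x)

⟦⟧-⇔ : ∀ {a b} {A : Set a} {B : Set b} (d : Dec A) (e : Dec B) → (A → B) → (B → A) → ⟦ d ⟧ ≡ ⟦ e ⟧
⟦⟧-⇔ (yes x) e f g = sym (⟦⟧-yes e (f x))
⟦⟧-⇔ (no ¬x) e f g = sym (⟦⟧-no e (¬x ∘ g))

∑ : {A : Set} → List A → (A → ℕ) → ℕ
∑ xs f = sum (map f xs)

∑-cong : ∀ {A : Set} (xs : List A) {f g : A → ℕ} → (∀ x → f x ≡ g x) → ∑ xs f ≡ ∑ xs g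
∑-cong []       h = refl
∑-cong (x ∷ xs) h = cong₂ _+_ (h x) (∑-cong xs h)

∑-cong-∈ : ∀ {A : Set} (xs : List A) {f g : A → ℕ} → (∀ {x} → x ∈ xs → f x ≡ g x) → ∑ xs f ≡ ∑ xs g
∑-cong-∈ []       h = refl
∑-cong-∈ (x ∷ xs) h = cong₂ _+_ (h (here refl)) (∑-cong-∈ xs (h ∘ there))

∑-const : ∀ {A : Set} (xs : List A) c → ∑ xs (λ _ → c) ≡ length xs * c
∑-const []       c = refl
∑-const (x ∷ xs) c = cong (c +_) (∑-const xs c)

∑-zero : ∀ {A : Set} (xs : List A) {f : A → ℕ} → (∀ x → f x ≡ 0) → ∑ xs f ≡ 0
∑-zero xs h = trans (∑-cong xs h) (trans (∑-const xs 0) (*-zeroʳ (length xs)))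

∑-+ : ∀ {A : Set} (xs : List A) (f g : A → ℕ) → ∑ xs (λ x → f x + g x) ≡ ∑ xs f + ∑ xs g
∑-+ []       f g = refl
∑-+ (x ∷ xs) f g = trans (cong (f x + g x +_) (∑-+ xs f g)) (+-interchange (f x) (g x) (∑ xs f) (∑ xs g))

∑-*ʳ : ∀ {A : Set} (xs : List A) (f : A → ℕ) c → ∑ xs (λ x → f x * c) ≡ ∑ xs f * c
∑-*ʳ []       f c = refl
∑-*ʳ (x ∷ xs) f c = trans (cong (f x * c +_) (∑-*ʳ xs f c)) (sym (*-distribʳ-+ c (f x) (∑ xs f)))

∑-swap : ∀ {A B : Set} (xs : List A) (ys : List B) (f : A → B → ℕ) →
         ∑ xs (λ x → ∑ ys (f x)) ≡ ∑ ys (λ y → ∑ xs (λ x → f x y))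
∑-swap []       ys f = sym (∑-zero ys (λ _ → refl))
∑-swap (x ∷ xs) ys f = trans (cong (∑ ys (f x) +_) (∑-swap xs ys f)) (sym (∑-+ ys (f x) (λ y → ∑ xs (λ x → f x y))))

-- Existence and uniqueness of the contributing entry are phrased by `Any` and `AllPairs`, which
-- fits lists without repetition as well as lists of orbit representatives.
∑-single : ∀ {A : Set} {P : A → Set} {f : A → ℕ} {c} {xs : List A} →
           (∀ {x} → P x → f x ≡ c) → (∀ {x} → ¬ P x → f x ≡ 0) →
           AllPairs (λ x y → ¬ (P x × P y)) xs → Any P xs → ∑ xs f ≡ c
∑-single {P = P} {f} {c} {x ∷ xs} on off (x≠ ∷ _) (here px) =
  trans (cong₂ _+_ (on px) (rest xs x≠)) (+-identityʳ c)
  where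
  rest : ∀ ys → All (λ y → ¬ (P x × P y)) ys → ∑ ys f ≡ 0
  rest []       []       = refl
  rest (y ∷ ys) (¬p ∷ ps) = cong₂ _+_ (off λ py → ¬p (px , py)) (rest ys ps)
∑-single {P = P} {f} {xs = x ∷ xs} on off (x≠ ∷ pairs) (there any) =
  cong₂ _+_ (off λ px → All.lookupWith (λ ¬p py → ¬p (px , py)) x≠ any)
    (∑-single on off pairs any)

∑-filter : ∀ {A : Set} {P : A → Set} (P? : ∀ x → Dec (P x)) xs → ∑ xs (λ x → ⟦ P? x ⟧) ≡ length (filter P? xs)
∑-filter P? [] = refl
∑-filter P? (x ∷ xs) with does (P? x)
... | true  = cong suc (∑-filter P? xs)
... | false = ∑-filter P? xs

∑< : ℕ → (ℕ → ℕ) → ℕ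
∑< n f = ∑ (upTo n) f

∑<-suc : ∀ n f → ∑< (suc n) f ≡ f 0 + ∑< n (f ∘ suc)
∑<-suc n f = cong (λ xs → f 0 + sum xs) (trans (map-applyUpTo suc f n) (sym (map-upTo (f ∘ suc) n)))

∑<-last : ∀ n f → ∑< (suc n) f ≡ ∑< n f + f n
∑<-last zero    f = +-comm (f 0) 0
∑<-last (suc n) f = begin
  ∑< (suc (suc n)) f              ≡⟨ ∑<-suc (suc n) f ⟩
  f 0 + ∑< (suc n) (f ∘ suc)      ≡⟨ cong (f 0 +_) (∑<-last n (f ∘ suc)) ⟩
  f 0 + (∑< n (f ∘ suc) + f (suc n)) ≡⟨ +-assoc (f 0) _ _ ⟨
  f 0 + ∑< n (f ∘ suc) + f (suc n)   ≡⟨ cong (_+ f (suc n)) (∑<-suc n f) ⟨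
  ∑< (suc n) f + f (suc n)        ∎
  where open ≡-Reasoning

-- Both sums arise from `∑< (suc n) f` by dropping one end term.
∑<-shift₁ : ∀ n f → f n ≡ f 0 → ∑< n (f ∘ suc) ≡ ∑< n f
∑<-shift₁ n f p = +-cancelˡ-≡ (f 0) _ _ (begin
  f 0 + ∑< n (f ∘ suc) ≡⟨ ∑<-suc n f ⟨
  ∑< (suc n) f         ≡⟨ ∑<-last n f ⟩
  ∑< n f + f n         ≡⟨ cong (∑< n f +_) p ⟩
  ∑< n f + f 0         ≡⟨ +-comm (∑< n f) (f 0) ⟩
  f 0 + ∑< n f         ∎)
  where open ≡-Reasoning

∑<-shift : ∀ m d f → (∀ {a b} → a ≡[ m ] b → f a ≡ f b) → ∑< (suc m) (λ c → f (c + d)) ≡ ∑< (suc m) f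
∑<-shift m zero    f per = ∑-cong (upTo (suc m)) (λ c → cong f (+-identityʳ c))
∑<-shift m (suc d) f per = trans (∑-cong (upTo (suc m)) (λ c → cong f (+-suc c d)))
  (trans (∑<-shift m d (f ∘ suc) (per ∘ mod-suc)) (∑<-shift₁ (suc m) f (per (mod (n%n≡0 (suc m))))))

-- Enumerating and counting strings with a property

enum : ∀ n (P : Vec Bool n → Bool) → List (Σ (Vec Bool n) (T ∘ P))
enum zero    P with T? (P [])
... | yes p = ([] , p) ∷ []
... | no _  = []
enum (suc n) P = map (λ (v , p) → false ∷ v , p) (enum n (P ∘ (false ∷_))) ++
                 map (λ (v , p) → true ∷ v , p) (enum n (P ∘ (true ∷_)))

enum-complete : ∀ n P x → x ∈ enum n P
enum-complete zero P ([] , p) with T? (P [])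
... | yes q = here (cong ([] ,_) (T-irrelevant p q))
... | no ¬p = contradiction p ¬p
enum-complete (suc n) P (false ∷ v , p) = ∈-++⁺ˡ (∈-map⁺ _ (enum-complete n _ (v , p)))
enum-complete (suc n) P (true ∷ v , p) = ∈-++⁺ʳ (map _ (enum n (P ∘ (false ∷_)))) (∈-map⁺ _ (enum-complete n _ (v , p)))

enum-unique : ∀ n P → Unique (enum n P)
enum-unique zero P with T? (P [])
... | yes _ = [] ∷ []
... | no _  = []
enum-unique (suc n) P = Unique.++⁺
  (Unique.map⁺ (λ { refl → refl }) (enum-unique n _)) (Unique.map⁺ (λ { refl → refl }) (enum-unique n _)) disjoint
  where
  disjoint : ∀ {v} → ¬ (v ∈ map (λ (v , p) → false ∷ v , p) (enum n (P ∘ (false ∷_))) ×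
                        v ∈ map (λ (v , p) → true ∷ v , p) (enum n (P ∘ (true ∷_))))
  disjoint (a , b) with ∈-map⁻ _ a | ∈-map⁻ _ b
  ... | _ , _ , refl | _ , _ , ()

-- Follows `enum` letter by letter, so that counts become numbers obeying recurrences, without any
-- list.
cnt : ∀ n → (Vec Bool n → Bool) → ℕ
cnt zero    P = if P [] then 1 else 0
cnt (suc n) P = cnt n (P ∘ (false ∷_)) + cnt n (P ∘ (true ∷_))

length-enum : ∀ n P → length (enum n P) ≡ cnt n P
length-enum zero P with T? (P [])
... | yes p = cong (if_then 1 else 0) (sym (T⇒≡ p))
... | no ¬p = cong (if_then 1 else 0) (sym (¬true⇒false (¬p ∘ ≡⇒T)))
length-enum (suc n) P = trans (length-++ (map _ (enum n (P ∘ (false ∷_)))))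
  (cong₂ _+_ (trans (length-map _ (enum n (P ∘ (false ∷_)))) (length-enum n _))
             (trans (length-map _ (enum n (P ∘ (true ∷_)))) (length-enum n _)))

-- Burnside's lemma

vertices : ∀ n → List (V n)
vertices n = enum n isLucas

~-decSetoid : ℕ → DecSetoid _ _
~-decSetoid m = record
  { Carrier = V (suc m) ; _≈_ = _~_
  ; isDecEquivalence = record
    { isEquivalence = record { refl = ~-refl ; sym = ~-sym ; trans = ~-trans } ; _≟_ = ~-dec } }

reps : ∀ m → List (V (suc m))
reps m = deduplicate ~-dec (vertices (suc m))

reps-distinct : ∀ m → AllPairs (λ u v → ¬ u ~ v) (reps m)
reps-distinct m = DecUnique.deduplicate-! (~-decSetoid m) (vertices (suc m))

reps-cover : ∀ m v → Any (λ u → u ~ v) (reps m)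
reps-cover m v = Any.map ~-sym (SetoidMembership.∈-deduplicate⁺ (DecSetoid.setoid (~-decSetoid m)) ~-dec
  (λ p q → ~-trans q (~-sym p)) (Any.map (λ { refl → ~-refl }) (enum-complete (suc m) isLucas v)))

-- Values of `c` are counted, one sign at a time, so coinciding maps contribute separately.
hits : ∀ {m} → Bool → V (suc m) → V (suc m) → ℕ
hits {m} s y r = ∑< (suc m) (λ c → ⟦ act s c y ≟ⱽ r ⟧)

fixed : ∀ m → Bool → ℕ → ℕ
fixed m s c = ∑ (vertices (suc m)) (λ y → ⟦ act s c y ≟ⱽ y ⟧)

-- Composing with the inverse of `(t , d)` turns maps from `y` to `act t d y` into stabilisers of
-- `y`; the signs multiply and `c` is merely shifted.
hits-translate : ∀ {m} s t d (y : V (suc m)) → hits s y (act t d y) ≡ hits (not (t xor s)) y y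
hits-translate {m} s t d y = trans (∑-cong (upTo (suc m)) same)
  (∑<-shift m (coef m s * inv m t d) (λ c → ⟦ act (not (t xor s)) c y ≟ⱽ y ⟧)
    (λ p → cong (λ u → ⟦ u ≟ⱽ y ⟧) (act-cong (not (t xor s)) y p)))
  where
  same : ∀ c → ⟦ act s c y ≟ⱽ act t d y ⟧ ≡ ⟦ act (not (t xor s)) (c + coef m s * inv m t d) y ≟ⱽ y ⟧
  same c = ⟦⟧-⇔ (act s c y ≟ⱽ act t d y) (act (not (t xor s)) (c + coef m s * inv m t d) y ≟ⱽ y)
    (λ p → trans (sym (act-act t s (inv m t d) c y)) (trans (cong (act t (inv m t d)) p) (act-inv t d y)))
    (λ p → trans (sym (inv-act t d (act s c y)))
             (cong (act t d) (trans (act-act t s (inv m t d) c y) p)))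

-- A reflection exchanges the two signs, so only their total is constant on an orbit.
hits-~ : ∀ {m} {y r : V (suc m)} → y ~ r → hits true y r + hits false y r ≡ hits true y y + hits false y y
hits-~ {y = y} (true  , d , refl) = cong₂ _+_ (hits-translate true true d y) (hits-translate false true d y)
hits-~ {y = y} (false , d , refl) = trans (cong₂ _+_ (hits-translate true false d y) (hits-translate false false d y))
  (+-comm (hits false y y) (hits true y y))

hits-≁ : ∀ {m} s {y r : V (suc m)} → ¬ y ~ r → hits s y r ≡ 0
hits-≁ {m} s {y} {r} ¬p = ∑-zero (upTo (suc m)) λ c → ⟦⟧-no (act s c y ≟ⱽ r) λ p → ¬p (s , c , p)

act-preimage : ∀ m s c (r : V (suc m)) → ∑ (vertices (suc m)) (λ y → ⟦ act s c y ≟ⱽ r ⟧) ≡ 1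
act-preimage m s c r = ∑-single {P = λ y → y ≡ act s (inv m s c) r}
  (λ { {y} refl → ⟦⟧-yes (act s c y ≟ⱽ r) (inv-act s c r) })
  (λ {y} ¬p → ⟦⟧-no (act s c y ≟ⱽ r) λ p → ¬p (trans (sym (act-inv s c y)) (cong (act s (inv m s c)) p)))
  (AllPairs.map (λ x≢y (p , q) → x≢y (trans p (sym q))) (enum-unique (suc m) isLucas))
  (Any.map sym (enum-complete (suc m) isLucas (act s (inv m s c) r)))

hits-total : ∀ m s (r : V (suc m)) → ∑ (vertices (suc m)) (λ y → hits s y r) ≡ suc m
hits-total m s r = begin
  ∑ (vertices (suc m)) (λ y → ∑< (suc m) (λ c → ⟦ act s c y ≟ⱽ r ⟧))
    ≡⟨ ∑-swap (vertices (suc m)) (upTo (suc m)) _ ⟩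
  ∑< (suc m) (λ c → ∑ (vertices (suc m)) (λ y → ⟦ act s c y ≟ⱽ r ⟧))
    ≡⟨ ∑-cong (upTo (suc m)) (λ c → act-preimage m s c r) ⟩
  ∑< (suc m) (λ _ → 1)
    ≡⟨ ∑-const (upTo (suc m)) 1 ⟩
  length (upTo (suc m)) * 1
    ≡⟨ trans (*-identityʳ _) (length-upTo (suc m)) ⟩
  suc m ∎
  where open ≡-Reasoning

-- Double count of the maps that carry some vertex to a representative. Each of the 2n maps hits a
-- given representative from exactly one vertex; each vertex reaches only the representative of its
-- own orbit, by as many maps as fix the vertex.
burnside : ∀ m → 2 * suc m * length (reps m) ≡ ∑< (suc m) (fixed m true) + ∑< (suc m) (fixed m false)
burnside m = begin
  2 * suc m * length (reps m)
    ≡⟨ *-comm (2 * suc m) (length (reps m)) ⟩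
  length (reps m) * (2 * suc m)
    ≡⟨ ∑-const (reps m) (2 * suc m) ⟨
  ∑ (reps m) (λ _ → 2 * suc m)
    ≡⟨ ∑-cong (reps m) (λ r → trans (cong (suc m +_) (+-identityʳ (suc m)))
         (sym (trans (∑-+ (vertices (suc m)) (λ y → hits true y r) (λ y → hits false y r))
           (cong₂ _+_ (hits-total m true r) (hits-total m false r))))) ⟩
  ∑ (reps m) (λ r → ∑ (vertices (suc m)) (λ y → hits true y r + hits false y r))
    ≡⟨ ∑-swap (reps m) (vertices (suc m)) _ ⟩
  ∑ (vertices (suc m)) (λ y → ∑ (reps m) (λ r → hits true y r + hits false y r))
    ≡⟨ ∑-cong (vertices (suc m)) orbit ⟩
  ∑ (vertices (suc m)) (λ y → hits true y y + hits false y y)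
    ≡⟨ ∑-+ (vertices (suc m)) (λ y → hits true y y) (λ y → hits false y y) ⟩
  ∑ (vertices (suc m)) (λ y → hits true y y) + ∑ (vertices (suc m)) (λ y → hits false y y)
    ≡⟨ cong₂ _+_ (∑-swap (vertices (suc m)) (upTo (suc m)) _) (∑-swap (vertices (suc m)) (upTo (suc m)) _) ⟩
  ∑< (suc m) (fixed m true) + ∑< (suc m) (fixed m false) ∎
  where
  open ≡-Reasoning
  orbit : ∀ y → ∑ (reps m) (λ r → hits true y r + hits false y r) ≡ hits true y y + hits false y y
  orbit y = ∑-single {P = λ r → r ~ y} (λ p → hits-~ (~-sym p))
    (λ ¬p → cong₂ _+_ (hits-≁ true (¬p ∘ ~-sym)) (hits-≁ false (¬p ∘ ~-sym)))
    (AllPairs.map (λ ¬p (p , q) → ¬p (~-trans p (~-sym q))) (reps-distinct m))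
    (reps-cover m y)

-- Fixed points of rotations

-- The bijection principle for lists. It matches fixed strings with shorter Lucas strings, and
-- numbers of given gcd with coprime residues.
count-image : ∀ {A B : Set} {P : A → Set} (_≟A_ : (x y : A) → Dec (x ≡ y)) (P? : ∀ x → Dec (P x))
              (xs : List A) (ys : List B) (h : B → A) → (∀ {v w} → h v ≡ h w → v ≡ w) →
              Unique xs → Unique ys →
              (∀ {w} → w ∈ ys → h w ∈ xs × P (h w)) →
              (∀ {x} → x ∈ xs → P x → ∃ λ w → w ∈ ys × h w ≡ x) →
              ∑ xs (λ x → ⟦ P? x ⟧) ≡ length ys
count-image {P = P} _≟A_ P? xs ys h inj xs! ys! into onto = begin
  ∑ xs (λ x → ⟦ P? x ⟧)                 ≡⟨ ∑-cong-∈ xs fibre ⟩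
  ∑ xs (λ x → ∑ ys (λ w → ⟦ h w ≟A x ⟧)) ≡⟨ ∑-swap xs ys _ ⟩
  ∑ ys (λ w → ∑ xs (λ x → ⟦ h w ≟A x ⟧)) ≡⟨ ∑-cong-∈ ys hit ⟩
  ∑ ys (λ _ → 1)                         ≡⟨ trans (∑-const ys 1) (*-identityʳ (length ys)) ⟩
  length ys                              ∎
  where
  open ≡-Reasoning
  fibre : ∀ {x} → x ∈ xs → ⟦ P? x ⟧ ≡ ∑ ys (λ w → ⟦ h w ≟A x ⟧)
  fibre {x} x∈ with P? x
  ... | yes px = sym (∑-single {P = λ w → h w ≡ x} (λ {w} p → ⟦⟧-yes (h w ≟A x) p) (λ {w} ¬p → ⟦⟧-no (h w ≟A x) ¬p)
                   (AllPairs.map (λ v≢w (p , q) → v≢w (inj (trans p (sym q)))) ys!)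
                   (let w , w∈ , p = onto x∈ px in Any.map (λ { refl → p }) w∈))
  ... | no ¬px = sym (trans (∑-cong-∈ ys λ {w} w∈ → ⟦⟧-no (h w ≟A x) λ { refl → ¬px (proj₂ (into w∈)) })
                   (∑-zero ys (λ _ → refl)))
  hit : ∀ {w} → w ∈ ys → ∑ xs (λ x → ⟦ h w ≟A x ⟧) ≡ 1
  hit {w} w∈ = ∑-single {P = λ x → h w ≡ x} (λ {x} p → ⟦⟧-yes (h w ≟A x) p) (λ {x} ¬p → ⟦⟧-no (h w ≟A x) ¬p)
    (AllPairs.map (λ x≢y (p , q) → x≢y (trans (sym p) q)) xs!) (proj₁ (into w∈))

-- Lucas strings are counted by Lucas numbers

cnt-cong : ∀ n {P Q : Vec Bool n → Bool} → (∀ v → P v ≡ Q v) → cnt n P ≡ cnt n Q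
cnt-cong zero    h = cong (if_then 1 else 0) (h [])
cnt-cong (suc n) h = cong₂ _+_ (cnt-cong n (h ∘ (false ∷_))) (cnt-cong n (h ∘ (true ∷_)))

cnt-false : ∀ n → cnt n (λ _ → false) ≡ 0
cnt-false zero    = refl
cnt-false (suc n) = cong₂ _+_ (cnt-false n) (cnt-false n)

-- Fillings of a gap bordered by `x` and `y`. A Lucas string with first letter `x` fills the gap
-- that leads around the cycle from `x` back to `x`.
between : Bool → Bool → ℕ → ℕ
between x y l = cnt l (λ w → noConsec (x ∷ (w ∷ʳ y)))

between-true : ∀ y l → between true y (suc l) ≡ between false y l
between-true y l = trans (cong (between false y l +_) (cnt-false l)) (+-identityʳ _)

noConsec-∷ʳ : ∀ {l} (u : Vec Bool (suc l)) y → noConsec (u ∷ʳ y) ≡ noConsec u ∧ not (last u ∧ y)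
noConsec-∷ʳ (x ∷ [])     y = Bool.∧-identityʳ _
noConsec-∷ʳ (x ∷ z ∷ xs) y = trans (cong (not (x ∧ z) ∧_) (noConsec-∷ʳ (z ∷ xs) y))
  (sym (∧-assoc (not (x ∧ z)) (noConsec (z ∷ xs)) (not (last (z ∷ xs) ∧ y))))

isLucas-cyclic : ∀ {l} x (u : Vec Bool l) → isLucas (x ∷ u) ≡ noConsec (x ∷ (u ∷ʳ x))
isLucas-cyclic x u = trans (cong (λ b → noConsec (x ∷ u) ∧ not b) (∧-comm x (last (x ∷ u)))) (sym (noConsec-∷ʳ (x ∷ u) x))

-- This is the identity L(l+1) = F(l+2) + F(l), split by the first letter.
between-lucas : ∀ l → between false false l + between true true l ≡ lucas (suc l)
between-lucas zero = refl
between-lucas (suc zero) = refl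
between-lucas (suc (suc l)) = begin
  between false false (suc l) + between true false (suc l) + between true true (suc (suc l))
    ≡⟨ cong₂ (λ a b → between false false (suc l) + a + b) (between-true false l) (between-true true (suc l)) ⟩
  between false false (suc l) + between false false l + (between false true l + between true true l)
    -- Read backwards: a gap from zero to one is a longer gap between ones, so both summands follow
    -- the Lucas recurrence.
    ≡⟨ cong (λ a → between false false (suc l) + between false false l + (a + between true true l)) (between-true true l) ⟨
  between false false (suc l) + between false false l + (between true true (suc l) + between true true l)
    ≡⟨ +-interchange (between false false (suc l)) (between false false l) (between true true (suc l)) (between true true l) ⟩
  between false false (suc l) + between true true (suc l) + (between false false l + between true true l)
    ≡⟨ cong₂ _+_ (between-lucas (suc l)) (between-lucas l) ⟩
  lucas (suc (suc (suc l))) ∎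
  where
  open ≡-Reasoning

length-vertices : ∀ l → length (vertices (suc l)) ≡ lucas (suc l)
length-vertices l = trans (length-enum (suc l) isLucas) (trans
  (cong₂ _+_ (cnt-cong l (isLucas-cyclic false)) (cnt-cong l (isLucas-cyclic true))) (between-lucas l))

mod-∣ : ∀ {e m} → suc e ∣ suc m → ∀ {a b} → a ≡[ m ] b → a ≡[ e ] b
mod-∣ {e} {m} d {a} {b} (mod p) = mod (trans (sym (m∣n⇒o%n%m≡o%m (suc e) (suc m) a d))
  (trans (cong (_% suc e) p) (m∣n⇒o%n%m≡o%m (suc e) (suc m) b d)))

∣⇒≡[]0 : ∀ {e c} → suc e ∣ c → c ≡[ e ] 0
∣⇒≡[]0 {e} (divides q refl) = mod-intro 0 q (+-identityʳ (q * suc e))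

repeat : ∀ {e m} → suc e ∣ suc m → V (suc e) → V (suc m)
repeat {e} {m} d w = mkV m (bit w) (bit-cong w ∘ mod-∣ d) (sparse w)

bit-repeat : ∀ {e m} (d : suc e ∣ suc m) w k → bit (repeat d w) k ≡ bit w k
bit-repeat {e} {m} d w = bit-mkV m (bit w) (bit-cong w ∘ mod-∣ d) (sparse w)

Period : (ℕ → Bool) → ℕ → Set
Period f d = ∀ k → f (k + d) ≡ f k

period-* : ∀ {f d} → Period f d → ∀ q → Period f (q * d)
period-* {f} {d} h zero    k = cong f (+-identityʳ k)
period-* {f} {d} h (suc q) k = trans (cong f (sym (+-assoc k d (q * d)))) (trans (period-* {f} {d} h q (k + d)) (h k))

-- By Bézout the gcd plus a multiple of one period is a multiple of the other; adding multiples of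
-- either period does not change `f`.
period-gcd : ∀ {f} c n → Period f c → Period f n → Period f (gcd c n)
period-gcd {f} c n hc hn k with Bézout.identity (gcd-GCD c n)
... | Bézout.+- x y eq = trans (sym (period-* {f} hn y (k + gcd c n)))
      (trans (cong f (trans (+-assoc k (gcd c n) (y * n)) (cong (k +_) eq))) (period-* {f} hc x k))
... | Bézout.-+ x y eq = trans (sym (period-* {f} hc x (k + gcd c n)))
      (trans (cong f (trans (+-assoc k (gcd c n) (x * c)) (cong (k +_) eq))) (period-* {f} hn y k))

Period⇒Periodic : ∀ {e f} → Period f (suc e) → Periodic e f
Period⇒Periodic {e} {f} h {a} {b} p = trans (reduce a) (trans (cong f (%-≡ p)) (sym (reduce b)))
  where
  reduce : ∀ a → f a ≡ f (a % suc e)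
  reduce a = trans (cong f (m≡m%n+[m/n]*n a (suc e))) (period-* {f} h (a / suc e) (a % suc e))

fixed⇒Period : ∀ {m} c (y : V (suc m)) → act true c y ≡ y → Period (bit y) c
fixed⇒Period c y p k = trans (cong (bit y) (trans (+-comm k c) (cong (c +_) (sym (*-identityˡ k)))))
  (trans (sym (bit-act true c y k)) (cong (λ u → bit u k) p))

-- The gcd enters as a variable so that matching can expose it as `suc e`, the length of the
-- repeated block.
fixed-rotation : ∀ m c {d} → gcd c (suc m) ≡ d → fixed m true c ≡ lucas d
fixed-rotation m c {zero} eq = contradiction eq (gcd[m,n]≢0 c (suc m) (inj₂ λ ()))
fixed-rotation m c {suc e} eq = trans
  (count-image _≟ⱽ_ (λ y → act true c y ≟ⱽ y) (vertices (suc m)) (vertices (suc e)) (repeat d∣n)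
    (λ {v} {w} p → bit-ext v w λ k → trans (sym (bit-repeat d∣n v k)) (trans (cong (λ u → bit u k) p) (bit-repeat d∣n w k)))
    (enum-unique (suc m) isLucas) (enum-unique (suc e) isLucas)
    (λ {w} _ → enum-complete (suc m) isLucas _ , repeat-fixed w)
    (λ {y} _ p → fold y p , enum-complete (suc e) isLucas _ , repeat-fold y p))
  (length-vertices e)
  where
  d∣n : suc e ∣ suc m
  d∣n = subst (_∣ suc m) eq (gcd[m,n]∣n c (suc m))
  d∣c : suc e ∣ c
  d∣c = subst (_∣ c) eq (gcd[m,n]∣m c (suc m))
  repeat-fixed : ∀ w → act true c (repeat d∣n w) ≡ repeat d∣n w
  repeat-fixed w = bit-ext (act true c (repeat d∣n w)) (repeat d∣n w) λ k → begin
    bit (act true c (repeat d∣n w)) k ≡⟨ bit-act true c (repeat d∣n w) k ⟩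
    bit (repeat d∣n w) (c + 1 * k)    ≡⟨ bit-repeat d∣n w (c + 1 * k) ⟩
    bit w (c + 1 * k)                 ≡⟨ bit-cong w (mod-+ʳ (1 * k) (∣⇒≡[]0 d∣c)) ⟩
    bit w (1 * k)                     ≡⟨ cong (bit w) (*-identityˡ k) ⟩
    bit w k                           ≡⟨ bit-repeat d∣n w k ⟨
    bit (repeat d∣n w) k              ∎
    where open ≡-Reasoning
  periodic : ∀ y → act true c y ≡ y → Periodic e (bit y)
  periodic y p = Period⇒Periodic {e} {bit y} (subst (Period (bit y)) eq
    (period-gcd {bit y} c (suc m) (fixed⇒Period c y p)
    (λ k → bit-cong y (mod-intro 0 1 (trans (+-identityʳ _) (cong (k +_) (sym (*-identityˡ (suc m)))))))))
  fold : ∀ y → act true c y ≡ y → V (suc e)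
  fold y p = mkV e (bit y) (periodic y p) (sparse y)
  repeat-fold : ∀ y p → repeat d∣n (fold y p) ≡ y
  repeat-fold y p = bit-ext (repeat d∣n (fold y p)) y λ k →
    trans (bit-repeat d∣n (fold y p) k) (bit-mkV e (bit y) (periodic y p) (sparse y) k)

-- Rotations grouped by their gcd with n

range : ℕ → List ℕ
range n = map suc (upTo n)

range-unique : ∀ n → Unique (range n)
range-unique n = Unique.map⁺ suc-injective (Unique.upTo⁺ n)

∈-range⁺ : ∀ {n k} → k ≢ 0 → k ≤ n → k ∈ range n
∈-range⁺ {n} {zero}  k≢0 _   = contradiction refl k≢0
∈-range⁺ {n} {suc k} _   k<n = ∈-map⁺ suc (∈-upTo⁺ k<n)

∈-range⁻ : ∀ {n k} → k ∈ range n → k ≢ 0 × k ≤ n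
∈-range⁻ {n} k∈ with ∈-map⁻ suc k∈
... | j , j∈ , refl = (λ ()) , ∈-upTo⁻ j∈

-- Multiplication by `d` takes the numbers up to n/d that are coprime to n/d to the numbers up to n
-- with gcd `d`. The denominator `suc (d ∸ 1)` is `d` in a visibly nonzero form.
count-gcd : ∀ m {d} → d ∣ suc m → ∑ (range (suc m)) (λ k → ⟦ gcd k (suc m) ≟ d ⟧) ≡ φ (suc m / suc (d ∸ 1))
count-gcd m {zero}  (divides q eq) = contradiction (trans eq (*-zeroʳ q)) λ ()
count-gcd m {suc e} d∣n = count-image _≟_ (λ k → gcd k (suc m) ≟ suc e) (range (suc m))
  (filter (λ j → gcd j q ≟ 1) (range q)) (suc e *_) (λ {v} {w} → *-cancelˡ-≡ v w (suc e))
  (range-unique (suc m)) (Unique.filter⁺ (λ j → gcd j q ≟ 1) (range-unique q)) into onto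
  where
  q : ℕ
  q = suc m / suc e
  n≡dq : suc e * q ≡ suc m
  n≡dq = m*[n/m]≡n d∣n
  scale : ∀ j → gcd (suc e * j) (suc m) ≡ suc e * gcd j q
  scale j = trans (cong (gcd (suc e * j)) (sym n≡dq)) (sym (c*gcd[m,n]≡gcd[cm,cn] (suc e) j q))
  into : ∀ {j} → j ∈ filter (λ j → gcd j q ≟ 1) (range q) →
         suc e * j ∈ range (suc m) × gcd (suc e * j) (suc m) ≡ suc e
  into {j} j∈ with ∈-filter⁻ (λ j → gcd j q ≟ 1) {xs = range q} j∈
  ... | j∈′ , coprime with ∈-range⁻ j∈′
  ...   | j≢0 , j≤q = ∈-range⁺ (j≢0 ∘ λ p → [ (λ ()) , id ]′ (m*n≡0⇒m≡0∨n≡0 (suc e) p))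
                        (subst (suc e * j ≤_) n≡dq (*-monoʳ-≤ (suc e) j≤q)) ,
                      trans (scale j) (trans (cong (suc e *_) coprime) (*-identityʳ (suc e)))
  onto : ∀ {k} → k ∈ range (suc m) → gcd k (suc m) ≡ suc e →
         ∃ λ j → j ∈ filter (λ j → gcd j q ≟ 1) (range q) × suc e * j ≡ k
  onto {k} k∈ eq with subst (_∣ k) eq (gcd[m,n]∣m k (suc m)) | ∈-range⁻ k∈
  ... | divides j refl | k≢0 , k≤n = j ,
      ∈-filter⁺ (λ j → gcd j q ≟ 1)
        (∈-range⁺ (λ { refl → k≢0 refl }) (*-cancelˡ-≤ (suc e) (subst₂ _≤_ (*-comm j (suc e)) (sym n≡dq) k≤n)))
        (*-cancelˡ-≡ (gcd j q) 1 (suc e) (trans (sym (scale j))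
          (trans (cong (λ z → gcd z (suc m)) (*-comm (suc e) j)) (trans eq (sym (*-identityʳ (suc e))))))) ,
      *-comm (suc e) j

∑-map : ∀ {A B : Set} (h : A → B) (f : B → ℕ) xs → ∑ (map h xs) f ≡ ∑ xs (f ∘ h)
∑-map h f xs = cong sum (sym (map-∘ xs))

sum-rotations : ∀ m → ∑< (suc m) (fixed m true) ≡ necklaceSum (suc m)
sum-rotations m = begin
  ∑< (suc m) (fixed m true)
    ≡⟨ ∑-cong (upTo (suc m)) (λ c → fixed-rotation m c refl) ⟩
  ∑< (suc m) (λ c → lucas (gcd c (suc m)))
    -- Totients and divisors are indexed from 1 to n; the rotations 0 and n have the same gcd with
    -- n.
    ≡⟨ ∑<-shift₁ (suc m) (λ c → lucas (gcd c (suc m))) (cong lucas ends) ⟨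
  ∑< (suc m) (λ c → lucas (gcd (suc c) (suc m)))
    ≡⟨ ∑-map suc (λ k → lucas (gcd k (suc m))) (upTo (suc m)) ⟨
  ∑ (range (suc m)) (λ k → lucas (gcd k (suc m)))
    -- Each term is spread over all divisors, only its own gcd contributing, so that the two sums
    -- can be exchanged.
    ≡⟨ ∑-cong-∈ (range (suc m)) by-gcd ⟨
  ∑ (range (suc m)) (λ k → ∑ (divisors (suc m)) (λ d → ⟦ gcd k (suc m) ≟ d ⟧ * lucas d))
    ≡⟨ ∑-swap (range (suc m)) (divisors (suc m)) _ ⟩
  ∑ (divisors (suc m)) (λ d → ∑ (range (suc m)) (λ k → ⟦ gcd k (suc m) ≟ d ⟧ * lucas d))
    ≡⟨ ∑-cong-∈ (divisors (suc m)) (λ {d} d∈ →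
         trans (∑-*ʳ (range (suc m)) (λ k → ⟦ gcd k (suc m) ≟ d ⟧) (lucas d))
           (cong (_* lucas d) (count-gcd m (proj₂ (∈-filter⁻ (_∣? suc m) {xs = range (suc m)} d∈))))) ⟩
  necklaceSum (suc m) ∎
  where
  open ≡-Reasoning
  ends : gcd (suc m) (suc m) ≡ gcd 0 (suc m)
  ends = trans (∣-antisym (gcd[m,n]∣m (suc m) (suc m)) (gcd-greatest ∣-refl ∣-refl)) (sym (gcd-identityˡ (suc m)))
  by-gcd : ∀ {k} → k ∈ range (suc m) →
           ∑ (divisors (suc m)) (λ d → ⟦ gcd k (suc m) ≟ d ⟧ * lucas d) ≡ lucas (gcd k (suc m))
  by-gcd {k} _ = ∑-single {P = gcd k (suc m) ≡_}
    (λ { {d} refl → trans (cong (_* lucas d) (⟦⟧-yes (gcd k (suc m) ≟ d) refl)) (*-identityˡ (lucas d)) })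
    (λ {d} ¬p → cong (_* lucas d) (⟦⟧-no (gcd k (suc m) ≟ d) ¬p))
    (AllPairs.map (λ d≢e (p , q) → d≢e (trans (sym p) q)) (Unique.filter⁺ (_∣? suc m) (range-unique (suc m))))
    (∈-filter⁺ (_∣? suc m) (∈-range⁺ (gcd[m,n]≢0 k (suc m) (inj₂ λ ())) (∣⇒≤ (gcd[m,n]∣n k (suc m))))
      (gcd[m,n]∣n k (suc m)))

-- Fixed points of reflections

∑-act : ∀ m s d (f : V (suc m) → ℕ) → ∑ (vertices (suc m)) (f ∘ act s d) ≡ ∑ (vertices (suc m)) f
∑-act m s d f = begin
  ∑ Vs (f ∘ act s d)
    ≡⟨ ∑-cong Vs (λ x → ∑-single {P = act s d x ≡_}
         (λ { {y} refl → trans (cong (_* f y) (⟦⟧-yes (act s d x ≟ⱽ y) refl)) (*-identityˡ (f y)) })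
         (λ {y} ¬p → cong (_* f y) (⟦⟧-no (act s d x ≟ⱽ y) ¬p))
         (AllPairs.map (λ y≢z (p , q) → y≢z (trans (sym p) q)) (enum-unique (suc m) isLucas))
         (enum-complete (suc m) isLucas (act s d x))) ⟨
  ∑ Vs (λ x → ∑ Vs (λ y → ⟦ act s d x ≟ⱽ y ⟧ * f y))
    ≡⟨ ∑-swap Vs Vs _ ⟩
  ∑ Vs (λ y → ∑ Vs (λ x → ⟦ act s d x ≟ⱽ y ⟧ * f y))
    ≡⟨ ∑-cong Vs (λ y → trans (∑-*ʳ Vs (λ x → ⟦ act s d x ≟ⱽ y ⟧) (f y))
         (trans (cong (_* f y) (act-preimage m s d y)) (*-identityˡ (f y)))) ⟩
  ∑ Vs f ∎
  where
  open ≡-Reasoning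
  Vs = vertices (suc m)

-- Conjugation by a one-step rotation moves the axis of a reflection by two.
fixed-reflection-+2 : ∀ m c → fixed m false (2 + c) ≡ fixed m false c
fixed-reflection-+2 m c = trans (∑-cong (vertices (suc m)) conjugate)
  (∑-act m true 1 (λ y → ⟦ act false c y ≟ⱽ y ⟧))
  where
  shift : ∀ c m → 2 + c + m * 1 + 0 * (1 + m) ≡ 1 + 1 * c + 1 * (1 + m)
  shift = solve-∀
  commute : ∀ y → act true 1 (act false (2 + c) y) ≡ act false c (act true 1 y)
  commute y = trans (act-act true false 1 (2 + c) y)
    (trans (act-cong false y (mod-intro 0 1 (shift c m))) (sym (act-act false true c 1 y)))
  conjugate : ∀ y → ⟦ act false (2 + c) y ≟ⱽ y ⟧ ≡ ⟦ act false c (act true 1 y) ≟ⱽ act true 1 y ⟧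
  conjugate y = ⟦⟧-⇔ (act false (2 + c) y ≟ⱽ y) (act false c (act true 1 y) ≟ⱽ act true 1 y)
    (λ p → trans (sym (commute y)) (cong (act true 1) p))
    (λ p → trans (sym (act-inv true 1 _)) (trans
      (cong (act true (inv m true 1)) (trans (commute y) p)) (act-inv true 1 y)))

-- Moving an axis by two preserves its count, so `R c + R (suc c)` is constant, whatever the parity
-- of n. The pair -1, 0 is chosen because these two reflections act by plain reversals.
sum-two-axes : ∀ m → 2 * ∑< (suc m) (fixed m false) ≡ suc m * (fixed m false m + fixed m false 0)
sum-two-axes m = begin
  2 * ∑< (suc m) R
    ≡⟨ cong (∑< (suc m) R +_) (+-identityʳ _) ⟩
  ∑< (suc m) R + ∑< (suc m) R
    ≡⟨ cong (∑< (suc m) R +_) (∑<-shift₁ (suc m) R (R-cong (mod (n%n≡0 (suc m))))) ⟨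
  ∑< (suc m) R + ∑< (suc m) (R ∘ suc)
    ≡⟨ ∑-+ (upTo (suc m)) R (R ∘ suc) ⟨
  ∑< (suc m) (λ c → R c + R (suc c))
    ≡⟨ ∑-cong (upTo (suc m)) (λ c → trans (constant c) (sym (constant m))) ⟩
  ∑< (suc m) (λ _ → R m + R (suc m))
    ≡⟨ trans (∑-const (upTo (suc m)) _) (cong (_* (R m + R (suc m))) (length-upTo (suc m))) ⟩
  suc m * (R m + R (suc m))
    ≡⟨ cong (λ a → suc m * (R m + a)) (R-cong (mod (n%n≡0 (suc m)))) ⟩
  suc m * (R m + R 0) ∎
  where
  open ≡-Reasoning
  R = fixed m false
  R-cong : ∀ {a b} → a ≡[ m ] b → R a ≡ R b
  R-cong p = ∑-cong (vertices (suc m)) λ y → cong (λ u → ⟦ u ≟ⱽ y ⟧) (act-cong false y p)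
  constant : ∀ c → R c + R (suc c) ≡ R 0 + R 1
  constant zero    = refl
  constant (suc c) = trans (cong (R (suc c) +_) (fixed-reflection-+2 m c))
    (trans (+-comm (R (suc c)) (R c)) (constant c))

get-∷ʳ-< : ∀ {l} (u : Vec Bool l) y {k} → k < l → get (u ∷ʳ y) k ≡ get u k
get-∷ʳ-< (x ∷ u) y {zero}  _       = refl
get-∷ʳ-< (x ∷ u) y {suc k} (s≤s p) = get-∷ʳ-< u y p

get-∷ʳ-end : ∀ {l} (u : Vec Bool l) y → get (u ∷ʳ y) l ≡ y
get-∷ʳ-end []      y = refl
get-∷ʳ-end (x ∷ u) y = get-∷ʳ-end u y

get-reverse : ∀ {l} (u : Vec Bool l) {k} → k < l → get (reverse u) k ≡ get u (l ∸ suc k)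
get-reverse {suc l} (x ∷ u) {k} (s≤s k≤l) rewrite reverse-∷ x u with m≤n⇒m<n∨m≡n k≤l
... | inj₁ k<l  = trans (get-∷ʳ-< (reverse u) x k<l) (trans (get-reverse u k<l)
                    (cong (get (x ∷ u)) (sym (+-∸-assoc 1 k<l))))
... | inj₂ refl = trans (get-∷ʳ-end (reverse u) x) (cong (get (x ∷ u)) (sym (n∸n≡0 k)))

-- With `m` read as -1 the left side is -1 - r.
reflect-index : ∀ m {r} → r ≤ m → m + m * r ≡[ m ] m ∸ r
reflect-index m {r} r≤m = mod-intro 0 r (trans (cong (λ z → z + m * r + 0) (sym (m∸n+n≡m r≤m))) (expand (m ∸ r) r m))
  where
  expand : ∀ d r m → d + r + m * r + 0 ≡ d + r * (1 + m)
  expand = solve-∀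

-- The map k ↦ -1 - k exchanges the first and last position: its axis crosses the edge joining them.
act-edge-axis : ∀ {m} (y : V (suc m)) → proj₁ (act false m y) ≡ reverse (proj₁ y)
act-edge-axis {m} y = at-ext (proj₁ (act false m y)) (reverse (proj₁ y)) λ k → begin
  bit (act false m y) k            ≡⟨ bit-act false m y k ⟩
  bit y (m + m * k)                ≡⟨ bit-cong y (mod-affine m m (≡[]-sym (%-≡[] k))) ⟩
  bit y (m + m * (k % suc m))      ≡⟨ bit-cong y (reflect-index m (s≤s⁻¹ (m%n<n k (suc m)))) ⟩
  bit y (m ∸ k % suc m)            ≡⟨ at-< (proj₁ y) (s≤s (m∸n≤m m (k % suc m))) ⟩
  get (proj₁ y) (m ∸ k % suc m)    ≡⟨ get-reverse (proj₁ y) (m%n<n k (suc m)) ⟨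
  at (reverse (proj₁ y)) k         ∎
  where open ≡-Reasoning

-- The map k ↦ -k fixes position 0, whose letter `b` splits off.
act-vertex-axis : ∀ {m} b (w : Vec Bool m) (p : T (isLucas (b ∷ w))) →
                  proj₁ (act false 0 (b ∷ w , p)) ≡ b ∷ reverse w
act-vertex-axis {m} b w p = at-ext (proj₁ (act false 0 y)) (b ∷ reverse w) λ k → begin
  bit (act false 0 y) k           ≡⟨ bit-act false 0 y k ⟩
  bit y (m * k)                   ≡⟨ bit-cong y (mod-affine 0 m (≡[]-sym (%-≡[] k))) ⟩
  bit y (m * (k % suc m))         ≡⟨ residue (k % suc m) (m%n<n k (suc m)) ⟩
  at (b ∷ reverse w) k            ∎
  where
  open ≡-Reasoning
  y = b ∷ w , p
  residue : ∀ r → r < suc m → bit y (m * r) ≡ get (b ∷ reverse w) r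
  residue zero    _         = cong (bit y) (*-zeroʳ m)
  residue (suc j) (s≤s j<m) = begin
    bit y (m * suc j)             ≡⟨ cong (bit y) (*-suc m j) ⟩
    bit y (m + m * j)             ≡⟨ bit-cong y (reflect-index m (<⇒≤ j<m)) ⟩
    bit y (m ∸ j)                 ≡⟨ at-< (proj₁ y) (s≤s (m∸n≤m m j)) ⟩
    get (b ∷ w) (m ∸ j)           ≡⟨ cong (get (b ∷ w)) (+-∸-assoc 1 j<m) ⟩
    get w (m ∸ suc j)             ≡⟨ get-reverse w j<m ⟨
    get (reverse w) j             ∎

-- Counting palindromes without consecutive ones

palindrome? : ∀ {n} (u : Vec Bool n) → Dec (reverse u ≡ u)
palindrome? u = ≡-dec Bool._≟_ (reverse u) u

isPal : ∀ {n} → Vec Bool n → Bool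
isPal u = does (palindrome? u)

does-⇔ : ∀ {a b} {A : Set a} {B : Set b} (d : Dec A) (e : Dec B) → (A → B) → (B → A) → does d ≡ does e
does-⇔ (yes x) e f g = sym (Dec.dec-true e (f x))
does-⇔ (no ¬x) e f g = sym (Dec.dec-false e (¬x ∘ g))

reverse-ends : ∀ {n} b c (w : Vec Bool n) → reverse (b ∷ (w ∷ʳ c)) ≡ c ∷ (reverse w ∷ʳ b)
reverse-ends b c w = trans (reverse-∷ b (w ∷ʳ c)) (cong (_∷ʳ b) (reverse-∷ʳ w c))
  where
  reverse-∷ʳ : ∀ {n} (w : Vec Bool n) c → reverse (w ∷ʳ c) ≡ c ∷ reverse w
  reverse-∷ʳ []      c = refl
  reverse-∷ʳ (x ∷ w) c = trans (reverse-∷ x (w ∷ʳ c)) (trans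
    (cong (_∷ʳ x) (reverse-∷ʳ w c)) (cong (c ∷_) (sym (reverse-∷ x w))))

isPal-ends : ∀ {n} b (w : Vec Bool n) → isPal (b ∷ (w ∷ʳ b)) ≡ isPal w
isPal-ends b w = does-⇔ (palindrome? (b ∷ (w ∷ʳ b))) (palindrome? w)
  (λ p → proj₁ (∷ʳ-injective (reverse w) w (proj₂ (∷-injective (trans (sym (reverse-ends b b w)) p)))))
  (λ p → trans (reverse-ends b b w) (cong (λ v → b ∷ (v ∷ʳ b)) p))

isPal-≢ : ∀ {n} b c (w : Vec Bool n) → b ≢ c → isPal (b ∷ (w ∷ʳ c)) ≡ false
isPal-≢ b c w b≢c = Dec.dec-false (palindrome? (b ∷ (w ∷ʳ c)))
  λ p → b≢c (sym (proj₁ (∷-injective (trans (sym (reverse-ends b c w)) p))))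

∑-++ : ∀ {A : Set} (xs ys : List A) f → ∑ (xs ++ ys) f ≡ ∑ xs f + ∑ ys f
∑-++ []       ys f = refl
∑-++ (x ∷ xs) ys f = trans (cong (f x +_) (∑-++ xs ys f)) (sym (+-assoc (f x) _ _))

∑-enum : ∀ n P (Q : Vec Bool n → Bool) → ∑ (enum n P) (λ x → if Q (proj₁ x) then 1 else 0) ≡ cnt n (λ u → P u ∧ Q u)
∑-enum zero P Q with T? (P [])
... | yes p = trans (+-identityʳ _) (cong (λ b → if b ∧ Q [] then 1 else 0) (sym (T⇒≡ p)))
... | no ¬p = cong (λ b → if b ∧ Q [] then 1 else 0) (sym (¬true⇒false (¬p ∘ ≡⇒T)))
∑-enum (suc n) P Q = trans (∑-++ (map _ (enum n (P ∘ (false ∷_)))) (map _ (enum n (P ∘ (true ∷_)))) _)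
  (cong₂ _+_ (trans (∑-map _ _ (enum n (P ∘ (false ∷_)))) (∑-enum n _ (Q ∘ (false ∷_))))
             (trans (∑-map _ _ (enum n (P ∘ (true ∷_)))) (∑-enum n _ (Q ∘ (true ∷_)))))

-- Peeling equal end letters `b` off a palindrome leaves a palindrome bordered by `b`; recording the
-- border letter therefore gives closed recurrences in steps of two.
palBetween : ∀ {n} → Bool → Vec Bool n → Bool
palBetween x w = noConsec (x ∷ (w ∷ʳ x)) ∧ isPal w

pal : Bool → ℕ → ℕ
pal x n = cnt n (palBetween x)

cnt-∷ʳ : ∀ n (P : Vec Bool (suc n) → Bool) → cnt (suc n) P ≡ cnt n (P ∘ (_∷ʳ false)) + cnt n (P ∘ (_∷ʳ true))
cnt-∷ʳ zero    P = refl
cnt-∷ʳ (suc n) P = trans (cong₂ _+_ (cnt-∷ʳ n (P ∘ (false ∷_))) (cnt-∷ʳ n (P ∘ (true ∷_))))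
  (+-interchange (cnt n (P ∘ (false ∷_) ∘ (_∷ʳ false))) _ _ _)

cnt-ends : ∀ n (P : Vec Bool (2 + n) → Bool) (Q₀ Q₁ : Vec Bool n → Bool) →
           (∀ w → P (false ∷ (w ∷ʳ false)) ≡ Q₀ w) → (∀ w → P (true ∷ (w ∷ʳ true)) ≡ Q₁ w) →
           (∀ b c w → b ≢ c → P (b ∷ (w ∷ʳ c)) ≡ false) → cnt (2 + n) P ≡ cnt n Q₀ + cnt n Q₁
cnt-ends n P Q₀ Q₁ h₀ h₁ h = cong₂ _+_
  (trans (cnt-∷ʳ n (P ∘ (false ∷_))) (trans (cong₂ _+_ (cnt-cong n h₀)
    (trans (cnt-cong n (λ w → h false true w λ ())) (cnt-false n))) (+-identityʳ _)))
  (trans (cnt-∷ʳ n (P ∘ (true ∷_))) (cong₂ _+_ (trans (cnt-cong n (λ w → h true false w λ ())) (cnt-false n)) (cnt-cong n h₁)))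

pal-ends : ∀ {n} x b (w : Vec Bool n) → palBetween x (b ∷ (w ∷ʳ b)) ≡ not (x ∧ b) ∧ palBetween b w
pal-ends x b w = trans
  (cong₂ (λ p q → (not (x ∧ b) ∧ p) ∧ q) (noConsec-∷ʳ (b ∷ (w ∷ʳ b)) x) (isPal-ends b w))
  (trans (cong (λ z → (not (x ∧ b) ∧ (noConsec (b ∷ (w ∷ʳ b)) ∧ not (z ∧ x))) ∧ isPal w) (last-∷ʳ b (b ∷ w)))
    (simplify x b (noConsec (b ∷ (w ∷ʳ b))) (isPal w)))
  where
  simplify : ∀ x b p q → (not (x ∧ b) ∧ (p ∧ not (b ∧ x))) ∧ q ≡ not (x ∧ b) ∧ (p ∧ q)
  simplify true  true  p q = refl
  simplify true  false p q = cong (_∧ q) (∧-identityʳ p)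
  simplify false true  p q = cong (_∧ q) (∧-identityʳ p)
  simplify false false p q = cong (_∧ q) (∧-identityʳ p)

pal-≢ : ∀ {n} x b c (w : Vec Bool n) → b ≢ c → palBetween x (b ∷ (w ∷ʳ c)) ≡ false
pal-≢ x b c w b≢c = trans (cong (noConsec (x ∷ ((b ∷ (w ∷ʳ c)) ∷ʳ x)) ∧_) (isPal-≢ b c w b≢c)) (∧-zeroʳ _)

pal-false : ∀ n → pal false (2 + n) ≡ pal false n + pal true n
pal-false n = cnt-ends n (palBetween false) (palBetween false) (palBetween true)
  (pal-ends false false) (pal-ends false true) (pal-≢ false)

pal-true : ∀ n → pal true (2 + n) ≡ pal false n
pal-true n = trans (cnt-ends n (palBetween true) (palBetween false) (λ _ → false)
    (pal-ends true false) (pal-ends true true) (pal-≢ true))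
  (trans (cong (pal false n +_) (cnt-false n)) (+-identityʳ _))

-- The end letters of a palindrome agree, so the Lucas condition makes both zero, which is what a
-- border of ones demands.
fixed-edge-axis : ∀ m → fixed m false m ≡ pal true (suc m)
fixed-edge-axis m = trans (∑-cong (vertices (suc m)) λ y → cong (if_then 1 else 0) (axis y))
  (trans (∑-enum (suc m) isLucas isPal) (cnt-cong (suc m) closed))
  where
  axis : ∀ y → does (act false m y ≟ⱽ y) ≡ isPal (proj₁ y)
  axis y = does-⇔ (act false m y ≟ⱽ y) (palindrome? (proj₁ y))
    (λ p → trans (sym (act-edge-axis y)) (cong proj₁ p)) (λ p → V-≡ (trans (act-edge-axis y) p))
  boolean : ∀ x z p → x ≡ z → p ∧ not (x ∧ z) ≡ not x ∧ (p ∧ not (z ∧ true))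
  boolean true  _ p refl = ∧-zeroʳ p
  boolean false _ p refl = refl
  closed : ∀ u → isLucas u ∧ isPal u ≡ noConsec (true ∷ (u ∷ʳ true)) ∧ isPal u
  closed u@(x ∷ xs) = by-cases (palindrome? u)
    where
    first≡last : reverse u ≡ u → x ≡ last u
    first≡last p = trans (sym (last-∷ʳ x (reverse xs))) (cong last (trans (sym (reverse-∷ x xs)) p))
    by-cases : Dec (reverse u ≡ u) → isLucas u ∧ isPal u ≡ noConsec (true ∷ (u ∷ʳ true)) ∧ isPal u
    by-cases (yes p) = cong (_∧ isPal u) (trans (boolean x (last u) (noConsec u) (first≡last p))
                         (cong (not x ∧_) (sym (noConsec-∷ʳ u true))))
    by-cases (no ¬p) rewrite Dec.dec-false (palindrome? u) ¬p = trans (∧-zeroʳ _) (sym (∧-zeroʳ _))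

-- Around the cycle, the letter on the axis borders the remaining palindrome on both sides.
fixed-vertex-axis : ∀ m → fixed m false 0 ≡ pal false m + pal true m
fixed-vertex-axis m = trans (∑-cong (vertices (suc m)) λ y → cong (if_then 1 else 0) (axis y))
  (trans (∑-enum (suc m) isLucas (isPal ∘ tail)) (cong₂ _+_
    (cnt-cong m λ w → cong (_∧ isPal w) (isLucas-cyclic false w))
    (cnt-cong m λ w → cong (_∧ isPal w) (isLucas-cyclic true w))))
  where
  axis : ∀ y → does (act false 0 y ≟ⱽ y) ≡ isPal (tail (proj₁ y))
  axis y@(b ∷ w , q) = does-⇔ (act false 0 y ≟ⱽ y) (palindrome? w)
    (λ p → proj₂ (∷-injective (trans (sym (act-vertex-axis b w q)) (cong proj₁ p))))
    (λ p → V-≡ (trans (act-vertex-axis b w q) (cong (b ∷_) p)))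

-- Diagonal sums of binomial coefficients

diagonal : ℕ → ℕ → ℕ
diagonal q a = (q ∸ ⌊ suc a /2⌋) C ⌊ a /2⌋

-- The Fibonacci number F(q+2): even `a = 2b` runs through C(q-b, b), a shallow diagonal of Pascal's
-- triangle, and odd `a = 2b+1` through C(q-1-b, b), the preceding one.
diagonalSum : ℕ → ℕ
diagonalSum q = ∑< (suc q) (diagonal q)

nC0≡1 : ∀ n → n C 0 ≡ 1
nC0≡1 n = trans (nCk≡nC[n∸k] {0} {n} z≤n) (nCn≡1 n)

-- Pascal's rule, where `a ≤ q` keeps `∸` from truncating.
diagonal-pascal : ∀ q {a} → a ≤ q → diagonal (2 + q) (2 + a) ≡ diagonal q a + diagonal (1 + q) (2 + a)
diagonal-pascal q {a} a≤q = trans (cong (_C suc ⌊ a /2⌋) (+-∸-assoc 1 (≤-trans (⌈n/2⌉≤n a) a≤q)))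
  (sym (nCk+nC[k+1]≡[n+1]C[k+1] (q ∸ ⌊ suc a /2⌋) ⌊ a /2⌋))

-- A padding term: with it the sum for `1 + q` can run as far as the one for `2 + q`.
diagonal-end : ∀ q → diagonal (1 + q) (2 + q) ≡ 0
diagonal-end q = k>n⇒nCk≡0 (s≤s (≤-reflexive
  (trans (cong (_∸ ⌈ q /2⌉) (sym (⌊n/2⌋+⌈n/2⌉≡n q))) (m+n∸n≡m ⌊ q /2⌋ ⌈ q /2⌉))))

-- The terms at 0 and 1 equal one for every diagonal; the others split by Pascal's rule.
diagonalSum-+2 : ∀ q → diagonalSum (2 + q) ≡ diagonalSum q + diagonalSum (1 + q)
diagonalSum-+2 q = begin
  ∑< (3 + q) (diagonal (2 + q))
    ≡⟨ head2 (2 + q) ⟩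
  2 + ∑< (1 + q) (λ a → diagonal (2 + q) (2 + a))
    ≡⟨ cong (2 +_) (trans (∑-cong-∈ (upTo (1 + q)) (λ a∈ → diagonal-pascal q (s≤s⁻¹ (∈-upTo⁻ a∈))))
         (∑-+ (upTo (1 + q)) (diagonal q) (λ a → diagonal (1 + q) (2 + a)))) ⟩
  2 + (diagonalSum q + ∑< (1 + q) (λ a → diagonal (1 + q) (2 + a)))
    ≡⟨ rotate (diagonalSum q) (∑< (1 + q) (λ a → diagonal (1 + q) (2 + a))) ⟩
  diagonalSum q + (2 + ∑< (1 + q) (λ a → diagonal (1 + q) (2 + a)))
    ≡⟨ cong (diagonalSum q +_) (head2 (1 + q)) ⟨
  diagonalSum q + ∑< (3 + q) (diagonal (1 + q))
    ≡⟨ cong (diagonalSum q +_) (trans (∑<-last (2 + q) (diagonal (1 + q)))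
         (trans (cong (diagonalSum (1 + q) +_) (diagonal-end q)) (+-identityʳ _))) ⟩
  diagonalSum q + diagonalSum (1 + q) ∎
  where
  open ≡-Reasoning
  rotate : ∀ a b → 2 + (a + b) ≡ a + (2 + b)
  rotate = solve-∀
  head2 : ∀ r → ∑< (3 + q) (diagonal r) ≡ 2 + ∑< (1 + q) (λ a → diagonal r (2 + a))
  head2 r = trans (∑<-suc (2 + q) (diagonal r)) (cong₂ _+_ (nC0≡1 r)
    (trans (∑<-suc (1 + q) (diagonal r ∘ suc)) (cong (_+ ∑< (1 + q) (λ a → diagonal r (2 + a))) (nC0≡1 (r ∸ 1)))))

-- Strings of length `1 + m` fixed by the edge axis plus those fixed by the vertex axis.
axes : ℕ → ℕ
axes m = pal true (1 + m) + (pal false m + pal true m)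

-- The palindrome counts advance in steps of two, so this is the Fibonacci recurrence within one
-- parity class of `m`.
axes-+4 : ∀ m → axes (4 + m) ≡ axes m + axes (2 + m)
axes-+4 m
  rewrite pal-true (3 + m) | pal-false (2 + m) | pal-true (2 + m) | pal-true (1 + m)
        | pal-false (1 + m) | pal-false m | pal-true m
  = rearrange (pal false (1 + m)) (pal true (1 + m)) (pal false m) (pal true m)
  where
  rearrange : ∀ a b c d → a + b + (c + d + c + (c + d)) ≡ b + (c + d) + (a + (c + d + c))
  rearrange = solve-∀

-- Both sides obey one second-order recurrence in steps of two; two initial values for each parity
-- make four base cases.
axes-diagonal : ∀ m → axes m ≡ 2 * diagonalSum ⌊ suc m /2⌋
axes-diagonal 0 = refl
axes-diagonal 1 = refl
axes-diagonal 2 = refl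
axes-diagonal 3 = refl
axes-diagonal (suc (suc (suc (suc m)))) = begin
  axes (4 + m)
    ≡⟨ axes-+4 m ⟩
  axes m + axes (2 + m)
    ≡⟨ cong₂ _+_ (axes-diagonal m) (axes-diagonal (suc (suc m))) ⟩
  2 * diagonalSum ⌊ suc m /2⌋ + 2 * diagonalSum (suc ⌊ suc m /2⌋)
    ≡⟨ *-distribˡ-+ 2 (diagonalSum ⌊ suc m /2⌋) (diagonalSum (suc ⌊ suc m /2⌋)) ⟨
  2 * (diagonalSum ⌊ suc m /2⌋ + diagonalSum (suc ⌊ suc m /2⌋))
    ≡⟨ cong (2 *_) (diagonalSum-+2 ⌊ suc m /2⌋) ⟨
  2 * diagonalSum (suc (suc ⌊ suc m /2⌋)) ∎
  where open ≡-Reasoning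

sum-reflections : ∀ m → ∑< (suc m) (fixed m false) ≡ suc m * binomSum (suc m)
sum-reflections m = *-cancelˡ-≡ _ _ 2 (begin
  2 * ∑< (suc m) (fixed m false)
    ≡⟨ sum-two-axes m ⟩
  suc m * (fixed m false m + fixed m false 0)
    ≡⟨ cong (suc m *_) (trans (cong₂ _+_ (fixed-edge-axis m) (fixed-vertex-axis m)) (axes-diagonal m)) ⟩
  suc m * (2 * binomSum (suc m))
    ≡⟨ rotate (suc m) (binomSum (suc m)) ⟩
  2 * (suc m * binomSum (suc m)) ∎)
  where
  open ≡-Reasoning
  rotate : ∀ n b → n * (2 * b) ≡ 2 * (n * b)
  rotate = solve-∀

theorem5p1 : ∀ (n : ℕ) → n ≥ 1 →
    Σ (List (V n)) (λ reps → IsOrbitTransversal n reps ×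
    (2 * n * length reps ≡ necklaceSum n + n * binomSum n))
theorem5p1 (suc m) _ = reps m ,
  (AllPairs.map (λ ¬p → ¬p ∘ SameOrbit⇒~) (reps-distinct m) , λ v → Any.map ~⇒SameOrbit (reps-cover m v)) ,
  trans (burnside m) (cong₂ _+_ (sum-rotations m) (sum-reflections m))
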